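{- The $\star$-insertion is a bijection from the set of all fully-commutative decreasing Hecke biwords to the set of all pairs $(P,Q)$ of tableaux of the same shape such that $P^t$ and $Q$ are semistandard and $\mathsf{row}(P)$ is fully-commutative.
   Context: The 0-Hecke monoid: words in positive integers modulo the equivalence generated by $pq=qp$ ($|p-q|>1$), $pqp=qpq$, $pp=p$ on consecutive subwords; a word is fully-commutative if no minimal-length word equivalent to it contains a consecutive subword $i(i+1)i$ or $i(i-1)i$. A fully-commutative decreasing Hecke biword is a two-row array with columns $[k_1;h_1],\dots,[k_N;h_N]$ (positive integers) such that $k_1\geqslant\cdots\geqslant k_N$, $h_j>h_{j+1}$ whenever $k_j=k_{j+1}$, and $h_1\cdots h_N$ is fully-commutative. Tableaux are in French notation (rows numbered from the bottom), with positive integer entries. $P^t$ semistandard means rows of $P$ strictly increase left to right and columns weakly increase bottom to top; $Q$ semistandard means rows weakly increase and columns strictly increase. $\mathsf{row}(P)$ reads rows from the top row down, each left to right. $\star$-insertion: read columns right to left, starting with $P,Q$ empty. For column $[q;x]$, insert $x$ into the bottom row of $P$, where inserting a letter $x$ into a row $R$ means: Case 1: if $R$ is empty or $x>\max(R)$, append $x$ to $R$, add a cell with entry $q$ to $Q$ in the same position, and stop. Case 2: otherwise if $x\notin R$, let $y$ be the smallest entry of $R$ with $y>x$, replace $y$ by $x$, and insert $y$ into the next row up. Case 3: if $x\in R$, let $y$ be the smallest entry of $R$ with $[y,x]\subseteq R$; $R$ is unchanged and $y$ is inserted into the next row up. The output is $\star([\mathbf{k},\mathbf{h}]^t)=(P,Q)$.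 -}

module Defs where

open import Data.Nat using (ℕ; zero; suc; _≤_; _<_; _≡ᵇ_; _<ᵇ_; _⊔_)
open import Data.Bool using (Bool; true; false; if_then_else_)
open import Data.List using (List; []; _∷_; _++_; [_]; length; map; foldr; filterᵇ; concat; reverse)
open import Data.Bool.ListAction using (any)
open import Data.List.Relation.Unary.All using (All)
open import Data.List.Relation.Unary.Linked using (Linked)
open import Data.Product using (_×_; _,_; Σ; ∃; ∃-syntax; proj₁; proj₂)
open import Data.Sum using (_⊎_)
open import Data.Unit using (⊤)
open import Data.Empty using (⊥)
open import Relation.Nullary using (¬_)
open import Relation.Binary.PropositionalEquality using (_≡_)
open import Relation.Binary.Construct.Closure.Equivalence using (EqClosure)

Word : Set
Word = List ℕ

data HStep : Word → Word → Set where
  comm  : ∀ u v p q → suc p < q ⊎ suc q < p →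
          HStep (u ++ p ∷ q ∷ v) (u ++ q ∷ p ∷ v)
  braid : ∀ u v p q → HStep (u ++ p ∷ q ∷ p ∷ v) (u ++ q ∷ p ∷ q ∷ v)
  idem  : ∀ u v p → HStep (u ++ p ∷ p ∷ v) (u ++ p ∷ v)

_≈H_ : Word → Word → Set
_≈H_ = EqClosure HStep

ContainsBraid : Word → Set
ContainsBraid w = ∃[ u ] ∃[ t ] ∃[ i ]
  (w ≡ u ++ i ∷ suc i ∷ i ∷ t ⊎ w ≡ u ++ suc i ∷ i ∷ suc i ∷ t)

MinimalIn : Word → Word → Set
MinimalIn v w = v ≈H w × (∀ v' → v' ≈H w → length v ≤ length v')

FullyCommutative : Word → Set
FullyCommutative w = ∀ v → MinimalIn v w → ¬ ContainsBraid v

-- Fully-commutative decreasing Hecke biwords.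
-- A biword is the list of its columns [k_j ; h_j] as pairs (k_j , h_j),
-- left to right.

Biword : Set
Biword = List (ℕ × ℕ)

DecCols : ℕ × ℕ → ℕ × ℕ → Set
DecCols (k , h) (k' , h') = k' ≤ k × (k ≡ k' → h' < h)

IsFCDecHeckeBiword : Biword → Set
IsFCDecHeckeBiword cs =
  All (λ c → 1 ≤ proj₁ c × 1 ≤ proj₂ c) cs ×
  Linked DecCols cs ×
  FullyCommutative (map proj₂ cs)

-- Tableaux: list of rows, bottom row first (French notation);
-- each row listed left to right.

Tableau : Set
Tableau = List (List ℕ)

NonEmpty : List ℕ → Set
NonEmpty [] = ⊥
NonEmpty (_ ∷ _) = ⊤

IsTableau : Tableau → Set
IsTableau T = All NonEmpty T × All (All (1 ≤_)) T ×
              Linked (λ r r' → length r' ≤ length r) T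

shape : Tableau → List ℕ
shape = map length

data ColRel (R : ℕ → ℕ → Set) : List ℕ → List ℕ → Set where
  done : ∀ {r} → ColRel R r []
  step : ∀ {a b r r'} → R a b → ColRel R r r' → ColRel R (a ∷ r) (b ∷ r')

TransposeSemistandard : Tableau → Set
TransposeSemistandard T = All (Linked _<_) T × Linked (ColRel _≤_) T

Semistandard : Tableau → Set
Semistandard T = All (Linked _≤_) T × Linked (ColRel _<_) T

rowWord : Tableau → Word
rowWord T = concat (reverse T)

_∈ᵇ_ : ℕ → List ℕ → Bool
x ∈ᵇ R = any (x ≡ᵇ_) R

maxL : List ℕ → ℕ
maxL = foldr _⊔_ 0

-- smallest y with [y, x] ⊆ R (assuming x ∈ R)
runStart : List ℕ → ℕ → ℕ
runStart R zero = zero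
runStart R (suc y) = if y ∈ᵇ R then runStart R y else suc y

minL : ℕ → List ℕ → ℕ
minL d [] = d
minL d (a ∷ as) = foldr (λ b m → if b <ᵇ m then b else m) a as

data RowResult : Set where
  appended : List ℕ → RowResult
  bumped   : List ℕ → ℕ → RowResult

insertRow : ℕ → List ℕ → RowResult
insertRow x [] = appended [ x ]
insertRow x R@(_ ∷ _) =
  if maxL R <ᵇ x then appended (R ++ [ x ])
  else if x ∈ᵇ R then bumped R (runStart R x)
  else (let y = minL x (filterᵇ (λ z → x <ᵇ z) R)
        in bumped (map (λ z → if z ≡ᵇ y then x else z) R) y)

insertP : ℕ → Tableau → Tableau × ℕ
insertP x [] = [ x ] ∷ [] , 0
insertP x (R ∷ Rs) with insertRow x R
... | appended R' = R' ∷ Rs , 0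
... | bumped R' y with insertP y Rs
...   | Rs' , i = R' ∷ Rs' , suc i

addCell : ℕ → ℕ → Tableau → Tableau
addCell q zero [] = [ q ] ∷ []
addCell q zero (r ∷ rs) = (r ++ [ q ]) ∷ rs
addCell q (suc i) [] = [ q ] ∷ []
addCell q (suc i) (r ∷ rs) = r ∷ addCell q i rs

starStep : ℕ × ℕ → Tableau × Tableau → Tableau × Tableau
starStep (q , x) (P , Q) with insertP x P
... | P' , i = P' , addCell q i Q

-- columns are read right to left (foldr processes the last column first)
star : Biword → Tableau × Tableau
star = foldr starStep ([] , [])

IsTargetPair : Tableau × Tableau → Set
IsTargetPair (P , Q) =
  IsTableau P × IsTableau Q × shape P ≡ shape Q ×
  TransposeSemistandard P × Semistandard Q × FullyCommutative (rowWord P)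

{-# OPTIONS --safe #-}

-- Each row insertion rewrites R x as y R′ in the 0-Hecke monoid, so row(P) represents the reversed
-- word h_N ⋯ h_1.  Full commutativity enters through one fact: no word of the class, reduced or
-- not, contains a braid.  Hence x + 1 ∉ R when x ∈ R is inserted, and y - 1 ∉ R′ when y ∈ R′ is
-- bumped back, which makes row insertion reversible and yields the Pieri property: of two successive
-- insertions, the second letter is larger exactly when its new cell lies in a weakly lower row.
-- The last cell is therefore the lowest of those carrying the largest entry of Q, so the
-- insertion can be undone one cell at a time.
module Submission where

open import Defs
open import Data.Bool using (true; false; T; if_then_else_)
open import Data.Empty using (⊥; ⊥-elim)
open import Data.List using (List; []; _∷_; _++_; [_]; length; map; reverse; concat; foldl; filterᵇ; initLast; _∷ʳ′_)
open import Data.List.Membership.Propositional using (_∈_; _∉_)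
open import Data.List.Membership.Propositional.Properties using (∈-++⁺ˡ; ∈-++⁺ʳ; ∈-++⁻; ∈-∃++)
open import Data.List.Properties using (++-assoc; ++-identityʳ; foldl-++; length-++; length-reverse; unfold-reverse; reverse-++; reverse-involutive;
  concat-++; ∷-injective; ∷-injectiveˡ; ∷-injectiveʳ; ∷ʳ-injective)
open import Data.List.Relation.Unary.All as All using (All; []; _∷_)
import Data.List.Relation.Unary.All.Properties as All
open import Data.List.Relation.Unary.AllPairs using (AllPairs; []; _∷_)
open import Data.List.Relation.Unary.Any as Any using (here; there)
import Data.List.Relation.Unary.Any.Properties as Any
open import Data.List.Relation.Unary.Linked as Linked using (Linked; []; [-]; _∷_)
open import Data.List.Relation.Unary.Linked.Properties using (Linked⇒AllPairs; AllPairs⇒Linked)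
open import Data.Nat
open import Data.Nat.ListAction using (sum)
open import Data.Nat.Properties
open import Data.Product using (_×_; _,_; ∃-syntax; proj₁; proj₂)
open import Data.Sum as Sum using (_⊎_; inj₁; inj₂; swap)
open import Data.Unit using (tt)
open import Function using (_∘_; _⇔_; mk⇔; Equivalence)
import Function.Properties.Equivalence as ⇔
open import Relation.Binary using (tri<; tri≈; tri>; Setoid)
import Relation.Binary.Construct.Closure.Equivalence as Eq
open import Relation.Binary.PropositionalEquality hiding ([_])
import Relation.Binary.Reasoning.Setoid as SetoidReasoning
open import Relation.Nullary using (¬_; yes; no; contradiction)
open import Data.List.Membership.DecPropositional _≟_ using (_∈?_)

-- The 0-Hecke congruence

open Setoid (Eq.setoid HStep) using ()
  renaming (refl to ≈-refl; sym to ≈-sym; trans to ≈-trans; reflexive to ≈-reflexive)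
module ≈-Reasoning = SetoidReasoning (Eq.setoid HStep)

-- The obstacle behind the fact on braids is a lower bound for word lengths, which the relations
-- themselves do not show. It comes from an action of the monoid on integer sequences that encode
-- normal forms. A letter lowers the sum of the sequence by one or fixes the sequence, so the total
-- drop bounds the length of every word of a class from below, and the word spelled by the sequence
-- attains the bound. A letter that fixes the sequence is absorbed. On the tableau side the
-- insertion is recast as relations free of Boolean tests, which can be read backwards. A trace of
-- the insertion stores with each step what makes that step reversible; injectivity says that a pair
-- of tableaux has at most one trace, surjectivity that a pair of the target has one.

++-congˡ : ∀ a {u v} → u ≈H v → (a ++ u) ≈H (a ++ v)
++-congˡ a = Eq.gmap (a ++_) step′
  where
  step′ : ∀ {u v} → HStep u v → HStep (a ++ u) (a ++ v)
  step′ (comm u v p q d) = subst₂ HStep (++-assoc a u _) (++-assoc a u _) (comm (a ++ u) v p q d)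
  step′ (braid u v p q)  = subst₂ HStep (++-assoc a u _) (++-assoc a u _) (braid (a ++ u) v p q)
  step′ (idem u v p)     = subst₂ HStep (++-assoc a u _) (++-assoc a u _) (idem (a ++ u) v p)

++-congʳ : ∀ b {u v} → u ≈H v → (u ++ b) ≈H (v ++ b)
++-congʳ b = Eq.gmap (_++ b) step′
  where
  step′ : ∀ {u v} → HStep u v → HStep (u ++ b) (v ++ b)
  step′ (comm u v p q d) = subst₂ HStep (sym (++-assoc u _ b)) (sym (++-assoc u _ b)) (comm u (v ++ b) p q d)
  step′ (braid u v p q)  = subst₂ HStep (sym (++-assoc u _ b)) (sym (++-assoc u _ b)) (braid u (v ++ b) p q)
  step′ (idem u v p)     = subst₂ HStep (sym (++-assoc u _ b)) (sym (++-assoc u _ b)) (idem u (v ++ b) p)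

reverse-split : ∀ (u s v : Word) → reverse (u ++ s ++ v) ≡ reverse v ++ reverse s ++ reverse u
reverse-split u s v = begin
  reverse (u ++ s ++ v)                  ≡⟨ reverse-++ u (s ++ v) ⟩
  reverse (s ++ v) ++ reverse u          ≡⟨ cong (_++ reverse u) (reverse-++ s v) ⟩
  (reverse v ++ reverse s) ++ reverse u  ≡⟨ ++-assoc (reverse v) (reverse s) (reverse u) ⟩
  reverse v ++ reverse s ++ reverse u    ∎
  where open ≡-Reasoning

reverse-cong : ∀ {u v} → u ≈H v → reverse u ≈H reverse v
reverse-cong = Eq.gmap reverse step′
  where
  step′ : ∀ {u v} → HStep u v → HStep (reverse u) (reverse v)
  step′ (comm u v p q d) =
    subst₂ HStep (sym (reverse-split u (p ∷ q ∷ []) v)) (sym (reverse-split u (q ∷ p ∷ []) v))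
      (comm (reverse v) (reverse u) q p (swap d))
  step′ (braid u v p q) =
    subst₂ HStep (sym (reverse-split u (p ∷ q ∷ p ∷ []) v)) (sym (reverse-split u (q ∷ p ∷ q ∷ []) v))
      (braid (reverse v) (reverse u) p q)
  step′ (idem u v p) =
    subst₂ HStep (sym (reverse-split u (p ∷ p ∷ []) v)) (sym (reverse-split u (p ∷ []) v))
      (idem (reverse v) (reverse u) p)

-- The relations preserve the set of letters of a word. This carries positivity between the letters
-- of a biword and the entries of `P`.
All-resp-≈H : ∀ {P : ℕ → Set} {u v} → u ≈H v → All P u → All P v
All-resp-≈H {P} u≈v = Equivalence.to (Eq.gfold ⇔.⇔-isEquivalence (All P) step′ u≈v)
  where
  middle : ∀ u {s t v} → (All P s → All P t) → All P (u ++ s ++ v) → All P (u ++ t ++ v)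
  middle u {s} f ps =
    All.++⁺ (All.++⁻ˡ u ps) (All.++⁺ (f (All.++⁻ˡ s (All.++⁻ʳ u ps))) (All.++⁻ʳ s (All.++⁻ʳ u ps)))
  step′ : ∀ {u v} → HStep u v → All P u ⇔ All P v
  step′ (comm u v p q _) = mk⇔ (middle u {p ∷ q ∷ []} {q ∷ p ∷ []} f) (middle u {q ∷ p ∷ []} {p ∷ q ∷ []} f)
    where
    f : ∀ {p q} → All P (p ∷ q ∷ []) → All P (q ∷ p ∷ [])
    f (a ∷ b ∷ []) = b ∷ a ∷ []
  step′ (braid u v p q) = mk⇔ (middle u {p ∷ q ∷ p ∷ []} {q ∷ p ∷ q ∷ []} f) (middle u {q ∷ p ∷ q ∷ []} {p ∷ q ∷ p ∷ []} f)
    where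
    f : ∀ {p q} → All P (p ∷ q ∷ p ∷ []) → All P (q ∷ p ∷ q ∷ [])
    f (a ∷ b ∷ _) = b ∷ a ∷ b ∷ []
  step′ (idem u v p) = mk⇔ (middle u {p ∷ p ∷ []} {p ∷ []} λ { (a ∷ _) → a ∷ [] })
                           (middle u {p ∷ []} {p ∷ p ∷ []} λ { (a ∷ []) → a ∷ a ∷ [] })

Far : ℕ → ℕ → Set
Far x b = suc x < b ⊎ suc b < x

commute-past : ∀ {x} B → All (Far x) B → (x ∷ B) ≈H (B ++ [ x ])
commute-past []      []       = ≈-refl
commute-past {x} (b ∷ B) (d ∷ ds) = begin
  x ∷ b ∷ B        ≈⟨ Eq.return (comm [] B x b d) ⟩
  b ∷ x ∷ B        ≈⟨ ++-congˡ [ b ] (commute-past B ds) ⟩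
  b ∷ B ++ [ x ]   ∎
  where open ≈-Reasoning

-- Codes: the list j_{n-1}, …, j_0 stands for the normal form D_0 ⋯ D_{n-1}, where
-- D_k = k (k-1) ⋯ j_k is a decreasing run, empty if j_k = k+1.  Right multiplication by a
-- letter acts on codes, whether or not the entries are in this range.

Code : Set
Code = List ℕ

data Position (x : ℕ) : ℕ → Set where
  far    : ∀ {j} → suc x < j → Position x j
  extend : Position x (suc x)
  absorb : Position x x
  past   : ∀ {j} → j < x → Position x j

position : ∀ x j → Position x j
position x j with <-cmp x j
... | tri> _ _ j<x = past j<x
... | tri≈ _ refl _ = absorb
... | tri< x<j _ _ with m≤n⇒m<n∨m≡n x<j
...   | inj₁ lt = far lt
...   | inj₂ refl = extend

-- A letter `x` multiplied on the right meets the last run, the head of the list, first. It commutes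
-- with letters above `x + 1`, prolongs a run ending in `x + 1`, merges with a final `x`, and
-- otherwise passes through the run and comes out as `x - 1`. A letter that gets past every run is
-- dropped, so the relations hold for all letters, whether or not they fit the code.
act : ℕ → Code → Code
act x [] = []
act x (j ∷ c) with position x j
... | far _  = j ∷ act x c
... | extend = x ∷ c
... | absorb = x ∷ c
... | past _ = j ∷ act (pred x) c

act-far : ∀ {x j} c → suc x < j → act x (j ∷ c) ≡ j ∷ act x c
act-far {x} {j} c p with position x j
... | far _  = refl
... | extend = contradiction p (<-irrefl refl)
... | absorb = contradiction p (≤⇒≯ (n≤1+n _))
... | past q = contradiction (<-trans q (<-trans (n<1+n _) p)) (<-irrefl refl)

act-extend : ∀ x c → act x (suc x ∷ c) ≡ x ∷ c
act-extend x c with position x (suc x)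
... | far p  = contradiction p (<-irrefl refl)
... | extend = refl
... | past q = contradiction q (≤⇒≯ (n≤1+n _))

act-absorb : ∀ x c → act x (x ∷ c) ≡ x ∷ c
act-absorb x c with position x x
... | far p  = contradiction p (≤⇒≯ (n≤1+n _))
... | absorb = refl
... | past q = contradiction q (<-irrefl refl)

act-past : ∀ {z j} c → j ≤ z → act (suc z) (j ∷ c) ≡ j ∷ act z c
act-past {z} {j} c p with position (suc z) j
... | far q  = contradiction (≤-trans (≤-trans (n≤1+n _) (≤-trans (n≤1+n _) q)) p) (<-irrefl refl)
... | extend = contradiction p (≤⇒≯ (n≤1+n _))
... | absorb = contradiction p (<-irrefl refl)
... | past _ = refl

act-idem : ∀ x c → act x (act x c) ≡ act x c
act-idem x [] = refl
act-idem x (j ∷ c) with position x j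
... | far p  = trans (act-far _ p) (cong (j ∷_) (act-idem x c))
... | extend = act-absorb x c
... | absorb = act-absorb x c
act-idem (suc z) (j ∷ c) | past (s≤s p) = trans (act-past _ p) (cong (j ∷_) (act-idem z c))

-- Passing a run costs a letter one, so the gap could shrink when only `y = z + 1` passes. But then
-- `x + 1 < j ≤ z` for the end `j` of that run, and the letters stay far apart.
act-comm : ∀ x y c → suc x < y → act y (act x c) ≡ act x (act y c)
act-comm x y [] d = refl
act-comm x (suc z) (j ∷ c) (s≤s d) with position x j
... | extend = trans (act-past _ (<⇒≤ d)) (sym (trans (cong (act x) (act-past c d)) (act-extend x _)))
... | absorb = trans (act-past _ (<⇒≤ d)) (sym (trans (cong (act x) (act-past c (<⇒≤ d))) (act-absorb x _)))
act-comm (suc w) (suc z) (j ∷ c) (s≤s d) | past (s≤s p) =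
  trans (act-past _ j≤z)
    (trans (cong (j ∷_) (act-comm w z c d))
      (sym (trans (cong (act (suc w)) (act-past c j≤z)) (act-past _ p))))
  where
  j≤z : j ≤ z
  j≤z = ≤-trans p (≤-trans (n≤1+n _) (≤-trans (n≤1+n _) d))
act-comm x (suc z) (j ∷ c) (s≤s d) | far p with position (suc z) j
... | far q  = trans (cong (j ∷_) (act-comm x (suc z) c (s≤s d))) (sym (act-far _ p))
... | extend = sym (act-far _ (s≤s d))
... | absorb = sym (act-far _ (s≤s d))
... | past (s≤s q) = trans (cong (j ∷_) (act-comm x z c (<-≤-trans p q))) (sym (act-far _ p))

-- If `j` is `x`, `x + 1` or `x + 2`, both sides equal `x ∷ act x c`. For any other `j`, both
-- letters are far from the run or both pass it, and the relation recurs on `c`.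
act-braid : ∀ x c → act x (act (suc x) (act x c)) ≡ act (suc x) (act x (act (suc x) c))
act-braid x [] = refl
act-braid x (j ∷ c) with position x j
... | extend = begin
  act x (act (suc x) (x ∷ c))                ≡⟨ cong (act x) (act-past c ≤-refl) ⟩
  act x (x ∷ act x c)                        ≡⟨ act-absorb x _ ⟩
  x ∷ act x c                                ≡⟨ act-past c ≤-refl ⟨
  act (suc x) (x ∷ c)                        ≡⟨ cong (act (suc x)) (act-extend x c) ⟨
  act (suc x) (act x (suc x ∷ c))            ≡⟨ cong (act (suc x) ∘ act x) (act-absorb (suc x) c) ⟨
  act (suc x) (act x (act (suc x) (suc x ∷ c))) ∎
  where open ≡-Reasoning
... | absorb = begin
  act x (act (suc x) (x ∷ c))                ≡⟨ cong (act x) (act-past c ≤-refl) ⟩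
  act x (x ∷ act x c)                        ≡⟨ act-absorb x _ ⟩
  x ∷ act x c                                ≡⟨ cong (x ∷_) (act-idem x c) ⟨
  x ∷ act x (act x c)                        ≡⟨ act-past _ ≤-refl ⟨
  act (suc x) (x ∷ act x c)                  ≡⟨ cong (act (suc x)) (act-absorb x _) ⟨
  act (suc x) (act x (x ∷ act x c))          ≡⟨ cong (act (suc x) ∘ act x) (act-past c ≤-refl) ⟨
  act (suc x) (act x (act (suc x) (x ∷ c)))  ∎
  where open ≡-Reasoning
act-braid (suc z) (j ∷ c) | past (s≤s p) = begin
  act x (act (suc x) (j ∷ act z c))     ≡⟨ cong (act x) (act-past _ p′) ⟩
  act x (j ∷ act x (act z c))           ≡⟨ act-past _ p ⟩
  j ∷ act z (act x (act z c))           ≡⟨ cong (j ∷_) (act-braid z c) ⟩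
  j ∷ act x (act z (act x c))           ≡⟨ act-past _ p′ ⟨
  act (suc x) (j ∷ act z (act x c))     ≡⟨ cong (act (suc x)) (act-past _ p) ⟨
  act (suc x) (act x (j ∷ act x c))     ≡⟨ cong (act (suc x) ∘ act x) (act-past _ p′) ⟨
  act (suc x) (act x (act (suc x) (j ∷ c))) ∎
  where
  open ≡-Reasoning
  x = suc z
  p′ : j ≤ suc z
  p′ = ≤-trans p (n≤1+n z)
act-braid x (j ∷ c) | far p with m≤n⇒m<n∨m≡n p
... | inj₂ refl = begin
  act x (act (suc x) (j ∷ act x c))    ≡⟨ cong (act x) (act-extend (suc x) _) ⟩
  act x (suc x ∷ act x c)              ≡⟨ act-extend x _ ⟩
  x ∷ act x c                          ≡⟨ act-past c ≤-refl ⟨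
  act (suc x) (x ∷ c)                  ≡⟨ cong (act (suc x)) (act-extend x c) ⟨
  act (suc x) (act x (suc x ∷ c))      ≡⟨ cong (act (suc x) ∘ act x) (act-extend (suc x) c) ⟨
  act (suc x) (act x (act (suc x) (j ∷ c))) ∎
  where open ≡-Reasoning
... | inj₁ q = begin
  act x (act (suc x) (j ∷ act x c))     ≡⟨ cong (act x) (act-far _ q) ⟩
  act x (j ∷ act (suc x) (act x c))     ≡⟨ act-far _ p ⟩
  j ∷ act x (act (suc x) (act x c))     ≡⟨ cong (j ∷_) (act-braid x c) ⟩
  j ∷ act (suc x) (act x (act (suc x) c)) ≡⟨ act-far _ q ⟨
  act (suc x) (j ∷ act x (act (suc x) c)) ≡⟨ cong (act (suc x)) (act-far _ p) ⟨
  act (suc x) (act x (j ∷ act (suc x) c)) ≡⟨ cong (act (suc x) ∘ act x) (act-far _ q) ⟨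
  act (suc x) (act x (act (suc x) (j ∷ c))) ∎
  where open ≡-Reasoning

-- The constructor braid is not restricted to adjacent letters.
act-braid-any : ∀ p q c → act p (act q (act p c)) ≡ act q (act p (act q c))
act-braid-any p q c with <-cmp p q
... | tri≈ _ refl _ = refl
... | tri< p<q _ _ with m≤n⇒m<n∨m≡n p<q
...   | inj₂ refl = act-braid p c
...   | inj₁ d = begin
  act p (act q (act p c))  ≡⟨ cong (act p) (act-comm p q c d) ⟩
  act p (act p (act q c))  ≡⟨ act-idem p (act q c) ⟩
  act p (act q c)          ≡⟨ cong (act p) (act-idem q c) ⟨
  act p (act q (act q c))  ≡⟨ act-comm p q (act q c) d ⟨
  act q (act p (act q c))  ∎
  where open ≡-Reasoning
act-braid-any p q c | tri> _ _ q<p with m≤n⇒m<n∨m≡n q<p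
...   | inj₂ refl = sym (act-braid q c)
...   | inj₁ d = begin
  act p (act q (act p c))  ≡⟨ act-comm q p (act p c) d ⟩
  act q (act p (act p c))  ≡⟨ cong (act q) (act-idem p c) ⟩
  act q (act p c)          ≡⟨ act-idem q (act p c) ⟨
  act q (act q (act p c))  ≡⟨ cong (act q) (act-comm q p c d) ⟨
  act q (act p (act q c))  ∎
  where open ≡-Reasoning

acts : Code → Word → Code
acts = foldl (λ c x → act x c)

acts-++ : ∀ c u v → acts c (u ++ v) ≡ acts (acts c u) v
acts-++ = foldl-++ (λ c x → act x c)

acts-resp-≈H : ∀ c {u v} → u ≈H v → acts c u ≡ acts c v
acts-resp-≈H c = Eq.gfold isEquivalence (acts c) step′
  where
  middle : ∀ u {s t} v → (∀ c → acts c s ≡ acts c t) → acts c (u ++ s ++ v) ≡ acts c (u ++ t ++ v)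
  middle u {s} {t} v f = begin
    acts c (u ++ s ++ v)           ≡⟨ acts-++ c u (s ++ v) ⟩
    acts (acts c u) (s ++ v)       ≡⟨ acts-++ (acts c u) s v ⟩
    acts (acts (acts c u) s) v     ≡⟨ cong (λ d → acts d v) (f (acts c u)) ⟩
    acts (acts (acts c u) t) v     ≡⟨ acts-++ (acts c u) t v ⟨
    acts (acts c u) (t ++ v)       ≡⟨ acts-++ c u (t ++ v) ⟨
    acts c (u ++ t ++ v)           ∎
    where open ≡-Reasoning
  step′ : ∀ {u v} → HStep u v → acts c u ≡ acts c v
  step′ (comm u v p q (inj₁ d)) = middle u {p ∷ q ∷ []} {q ∷ p ∷ []} v (λ c → act-comm p q c d)
  step′ (comm u v p q (inj₂ d)) = middle u {p ∷ q ∷ []} {q ∷ p ∷ []} v (λ c → sym (act-comm q p c d))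
  step′ (braid u v p q) = middle u {p ∷ q ∷ p ∷ []} {q ∷ p ∷ q ∷ []} v (act-braid-any p q)
  step′ (idem u v p) = middle u {p ∷ p ∷ []} {p ∷ []} v (act-idem p)

-- Only the case `extend` changes an entry, and by one. The sum thus measures length with the
-- opposite sign; `length-codeWord` makes this exact.
act-sum : ∀ x c → act x c ≡ c ⊎ suc (sum (act x c)) ≡ sum c
act-sum x [] = inj₁ refl
act-sum x (j ∷ c) with position x j
... | extend = inj₂ refl
... | absorb = inj₁ refl
... | far _ with act-sum x c
...   | inj₁ eq = inj₁ (cong (j ∷_) eq)
...   | inj₂ eq = inj₂ (trans (sym (+-suc j _)) (cong (j +_) eq))
act-sum x (j ∷ c) | past _ with act-sum (pred x) c
...   | inj₁ eq = inj₁ (cong (j ∷_) eq)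
...   | inj₂ eq = inj₂ (trans (sym (+-suc j _)) (cong (j +_) eq))

sum≤length+sum-acts : ∀ w c → sum c ≤ length w + sum (acts c w)
sum≤length+sum-acts [] c = ≤-refl
sum≤length+sum-acts (x ∷ w) c with act-sum x c
... | inj₁ eq = m≤n⇒m≤1+n (subst (λ d → sum d ≤ length w + sum (acts (act x c) w)) eq (sum≤length+sum-acts w (act x c)))
... | inj₂ eq = subst (_≤ suc (length w + sum (acts (act x c) w))) eq (s≤s (sum≤length+sum-acts w (act x c)))

-- Normal words of codes and their lengths

down : ℕ → ℕ → Word
down zero    j = []
down (suc d) j = d + j ∷ down d j

length-down : ∀ d j → length (down d j) ≡ d
length-down zero j = refl
length-down (suc d) j = cong suc (length-down d j)

down-snoc : ∀ d j → down (suc d) j ≡ down d (suc j) ++ [ j ]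
down-snoc zero j = refl
down-snoc (suc d) j = cong₂ _∷_ (sym (+-suc d j)) (down-snoc d j)

down-≥ : ∀ d j → All (j ≤_) (down d j)
down-≥ zero j = []
down-≥ (suc d) j = m≤n+m j d ∷ down-≥ d j

down-< : ∀ d j → All (_< d + j) (down d j)
down-< zero j = []
down-< (suc d) j = ≤-refl ∷ All.map m<n⇒m<1+n (down-< d j)

-- The letter `z + 1` commutes left past the letters below `z`, the braid relation turns
-- `(z+1) z (z+1)` into `z (z+1) z`, and the new `z` commutes past the letters above `z + 1`.
down-past : ∀ d j {z} → j ≤ z → suc z < d + j → (down d j ++ [ suc z ]) ≈H (z ∷ down d j)
down-past zero j p q = contradiction (<-≤-trans (<-trans (n<1+n _) q) p) (<-irrefl refl)
down-past (suc d) j {z} p (s≤s q) with m≤n⇒m<n∨m≡n q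
... | inj₁ q′ = begin
  d + j ∷ down d j ++ [ suc z ]  ≈⟨ ++-congˡ [ d + j ] (down-past d j p q′) ⟩
  d + j ∷ z ∷ down d j           ≈⟨ Eq.return (comm [] (down d j) (d + j) z (inj₂ q′)) ⟩
  z ∷ d + j ∷ down d j           ∎
  where open ≈-Reasoning
down-past (suc zero) j {z} p (s≤s q) | inj₂ refl = contradiction p (<-irrefl refl)
down-past (suc (suc d)) j {z} p (s≤s q) | inj₂ refl = begin
  suc z ∷ z ∷ down d j ++ [ suc z ]
    ≈⟨ ++-congˡ (suc z ∷ z ∷ []) (commute-past (down d j) (All.map (inj₂ ∘ s≤s) (down-< d j))) ⟨
  suc z ∷ z ∷ suc z ∷ down d j    ≈⟨ Eq.return (braid [] (down d j) (suc z) z) ⟩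
  z ∷ suc z ∷ z ∷ down d j        ∎
  where open ≈-Reasoning

-- The bound makes the run length `suc (length c) ∸ j` in `codeWord` a true subtraction.
data Valid : Code → Set where
  []  : Valid []
  _∷_ : ∀ {j c} → j ≤ suc (length c) → Valid c → Valid (j ∷ c)

codeWord : Code → Word
codeWord []      = []
codeWord (j ∷ c) = codeWord c ++ down (suc (length c) ∸ j) j

-- The code of the empty word, with every run empty. Its sum is the largest among the valid codes of
-- length `n`.
idCode : ℕ → Code
idCode zero    = []
idCode (suc n) = suc n ∷ idCode n

length-idCode : ∀ n → length (idCode n) ≡ n
length-idCode zero    = refl
length-idCode (suc n) = cong suc (length-idCode n)

idCode-valid : ∀ n → Valid (idCode n)
idCode-valid zero    = []
idCode-valid (suc n) = ≤-reflexive (cong suc (sym (length-idCode n))) ∷ idCode-valid n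

codeWord-idCode : ∀ n → codeWord (idCode n) ≡ []
codeWord-idCode zero = refl
codeWord-idCode (suc n) rewrite codeWord-idCode n | length-idCode n | n∸n≡0 n = refl

length-codeWord : ∀ {c} → Valid c → length (codeWord c) + sum c ≡ sum (idCode (length c))
length-codeWord [] = refl
length-codeWord {j ∷ c} (p ∷ v) = begin
  length (codeWord c ++ down (suc k ∸ j) j) + (j + sum c)
    ≡⟨ cong (_+ (j + sum c)) (length-++ (codeWord c)) ⟩
  (length (codeWord c) + length (down (suc k ∸ j) j)) + (j + sum c)
    ≡⟨ cong (λ d → (length (codeWord c) + d) + (j + sum c)) (length-down (suc k ∸ j) j) ⟩
  (length (codeWord c) + (suc k ∸ j)) + (j + sum c)
    ≡⟨ +-interchange (length (codeWord c)) (suc k ∸ j) j (sum c) ⟩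
  (suc k ∸ j + j) + (length (codeWord c) + sum c)
    ≡⟨ cong₂ _+_ (m∸n+n≡m p) (length-codeWord v) ⟩
  suc k + sum (idCode k) ∎
  where
  open ≡-Reasoning
  k = length c
  +-interchange : ∀ a b c d → (a + b) + (c + d) ≡ (b + c) + (a + d)
  +-interchange a b c d = begin
    (a + b) + (c + d)  ≡⟨ cong (_+ (c + d)) (+-comm a b) ⟩
    (b + a) + (c + d)  ≡⟨ +-assoc b a (c + d) ⟩
    b + (a + (c + d))  ≡⟨ cong (b +_) (+-comm a (c + d)) ⟩
    b + ((c + d) + a)  ≡⟨ cong (b +_) (+-assoc c d a) ⟩
    b + (c + (d + a))  ≡⟨ +-assoc b c (d + a) ⟨
    (b + c) + (d + a)  ≡⟨ cong ((b + c) +_) (+-comm d a) ⟩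
    (b + c) + (a + d)  ∎

length-act : ∀ x c → length (act x c) ≡ length c
length-act x [] = refl
length-act x (j ∷ c) with position x j
... | far _  = cong suc (length-act x c)
... | extend = refl
... | absorb = refl
... | past _ = cong suc (length-act (pred x) c)

act-valid : ∀ x {c} → Valid c → Valid (act x c)
act-valid x [] = []
act-valid x {j ∷ c} (p ∷ v) with position x j
... | far _  = subst (λ k → j ≤ suc k) (sym (length-act x c)) p ∷ act-valid x v
... | extend = <⇒≤ p ∷ v
... | absorb = p ∷ v
... | past _ = subst (λ k → j ≤ suc k) (sym (length-act (pred x) c)) p ∷ act-valid (pred x) v

-- One relation per case of `act`: commutation with the run, a longer run, idempotence at its last
-- letter, and `down-past`. The bound on `x` keeps a passing letter inside the run and its
-- predecessor in range for the shorter code.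
codeWord-act : ∀ x {c} → Valid c → x < length c → codeWord (act x c) ≈H (codeWord c ++ [ x ])
codeWord-act x {j ∷ c} (p ∷ v) x<n with position x j
... | far q rewrite length-act x c = begin
  codeWord (act x c) ++ D       ≈⟨ ++-congʳ D (codeWord-act x v (≤-pred (<-≤-trans q p))) ⟩
  (codeWord c ++ [ x ]) ++ D    ≡⟨ ++-assoc (codeWord c) [ x ] D ⟩
  codeWord c ++ x ∷ D           ≈⟨ ++-congˡ (codeWord c) (commute-past D (All.map (inj₁ ∘ <-≤-trans q) (down-≥ _ j))) ⟩
  codeWord c ++ D ++ [ x ]      ≡⟨ ++-assoc (codeWord c) D [ x ] ⟨
  (codeWord c ++ D) ++ [ x ]    ∎
  where
  open ≈-Reasoning
  D = down (suc (length c) ∸ j) j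
... | extend = ≈-reflexive (begin
  codeWord c ++ down (suc k ∸ x) x             ≡⟨ cong (λ d → codeWord c ++ down d x) (+-∸-assoc 1 (≤-pred p)) ⟩
  codeWord c ++ down (suc (k ∸ x)) x           ≡⟨ cong (codeWord c ++_) (down-snoc (k ∸ x) x) ⟩
  codeWord c ++ down (k ∸ x) (suc x) ++ [ x ]  ≡⟨ ++-assoc (codeWord c) _ [ x ] ⟨
  (codeWord c ++ down (k ∸ x) (suc x)) ++ [ x ] ∎)
  where
  open ≡-Reasoning
  k = length c
... | absorb rewrite +-∸-assoc 1 (≤-pred x<n) | down-snoc (length c ∸ x) x = begin
  codeWord c ++ D ++ [ x ]             ≈⟨ ++-congˡ (codeWord c) (++-congˡ D (Eq.return (idem [] [] x))) ⟨
  codeWord c ++ D ++ x ∷ x ∷ []        ≡⟨ cong (codeWord c ++_) (++-assoc D [ x ] [ x ]) ⟨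
  codeWord c ++ (D ++ [ x ]) ++ [ x ]  ≡⟨ ++-assoc (codeWord c) _ [ x ] ⟨
  (codeWord c ++ D ++ [ x ]) ++ [ x ]  ∎
  where
  open ≈-Reasoning
  D = down (length c ∸ x) (suc x)
codeWord-act (suc z) {j ∷ c} (p ∷ v) (s≤s z<k) | past (s≤s q) rewrite length-act z c = begin
  codeWord (act z c) ++ D         ≈⟨ ++-congʳ D (codeWord-act z v z<k) ⟩
  (codeWord c ++ [ z ]) ++ D      ≡⟨ ++-assoc (codeWord c) [ z ] D ⟩
  codeWord c ++ z ∷ D             ≈⟨ ++-congˡ (codeWord c) (down-past _ j q (subst (suc z <_) (sym (m∸n+n≡m p)) (s≤s z<k))) ⟨
  codeWord c ++ D ++ [ suc z ]    ≡⟨ ++-assoc (codeWord c) D [ suc z ] ⟨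
  (codeWord c ++ D) ++ [ suc z ]  ∎
  where
  open ≈-Reasoning
  D = down (suc (length c) ∸ j) j

codeWord-acts : ∀ w {c} → Valid c → All (_< length c) w → codeWord (acts c w) ≈H (codeWord c ++ w)
codeWord-acts [] {c} v [] = ≈-reflexive (sym (++-identityʳ (codeWord c)))
codeWord-acts (x ∷ w) {c} v (p ∷ ps) = begin
  codeWord (acts (act x c) w)
    ≈⟨ codeWord-acts w (act-valid x v) (subst (λ n → All (_< n) w) (sym (length-act x c)) ps) ⟩
  codeWord (act x c) ++ w        ≈⟨ ++-congʳ w (codeWord-act x v p) ⟩
  (codeWord c ++ [ x ]) ++ w     ≡⟨ ++-assoc (codeWord c) [ x ] w ⟩
  codeWord c ++ x ∷ w            ∎
  where open ≈-Reasoning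

acts-valid : ∀ w {c} → Valid c → Valid (acts c w)
acts-valid [] v = v
acts-valid (x ∷ w) v = acts-valid w (act-valid x v)

length-acts : ∀ w c → length (acts c w) ≡ length c
length-acts [] c = refl
length-acts (x ∷ w) c = trans (length-acts w (act x c)) (length-act x c)

code : ℕ → Word → Code
code n = acts (idCode n)

-- Equal codes therefore force equivalent words, which turns a code fixed by a letter into an
-- absorbed letter.
codeWord-code : ∀ n {w} → All (_< n) w → codeWord (code n w) ≈H w
codeWord-code n {w} ps = begin
  codeWord (code n w)
    ≈⟨ codeWord-acts w (idCode-valid n) (subst (λ m → All (_< m) w) (sym (length-idCode n)) ps) ⟩
  codeWord (idCode n) ++ w   ≡⟨ cong (_++ w) (codeWord-idCode n) ⟩
  w                          ∎
  where open ≈-Reasoning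

-- Minimal words

Minimal : Word → Set
Minimal w = ∀ v → v ≈H w → length w ≤ length v

reduced⇒minimal : ∀ n {w} → length w + sum (code n w) ≡ sum (idCode n) → Minimal w
reduced⇒minimal n {w} eq v v≈w = +-cancelʳ-≤ (sum (code n w)) (length w) (length v) (begin
  length w + sum (code n w)  ≡⟨ eq ⟩
  sum (idCode n)             ≤⟨ sum≤length+sum-acts v (idCode n) ⟩
  length v + sum (code n v)  ≡⟨ cong (λ c → length v + sum c) (acts-resp-≈H (idCode n) v≈w) ⟩
  length v + sum (code n w)  ∎)
  where open ≤-Reasoning

-- The competitor of `w` is the normal word of its code, whose length is exactly the drop of the
-- sum.
minimal⇒reduced : ∀ n {w} → All (_< n) w → Minimal w → length w + sum (code n w) ≡ sum (idCode n)
minimal⇒reduced n {w} ps min = ≤-antisym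
  (begin
    length w + sum (code n w)                        ≤⟨ +-monoˡ-≤ _ (min _ (codeWord-code n ps)) ⟩
    length (codeWord (code n w)) + sum (code n w)    ≡⟨ length-codeWord (acts-valid w (idCode-valid n)) ⟩
    sum (idCode (length (code n w)))                 ≡⟨ cong (sum ∘ idCode) (trans (length-acts w (idCode n)) (length-idCode n)) ⟩
    sum (idCode n)                                   ∎)
  (sum≤length+sum-acts w (idCode n))
  where open ≤-Reasoning

letters-bounded : (w : Word) → ∃[ n ] All (_< n) w
letters-bounded []      = 0 , []
letters-bounded (x ∷ w) with letters-bounded w
... | n , ps = suc x ⊔ n , m≤m⊔n (suc x) n ∷ All.map (λ p → ≤-trans p (m≤n⊔m (suc x) n)) ps

-- Either the letter lowers the sum by one, matching the increase in length, or it fixes the code,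
-- and then both words have the same normal word.
minimal-snoc : ∀ {w} x → Minimal w → Minimal (w ++ [ x ]) ⊎ w ≈H (w ++ [ x ])
minimal-snoc {w} x min with letters-bounded (w ++ [ x ])
... | n , ps with act-sum x (code n w)
...   | inj₁ eq = inj₂ (begin
  w                           ≈⟨ codeWord-code n (All.++⁻ˡ w ps) ⟨
  codeWord (code n w)         ≡⟨ cong codeWord (trans (acts-++ (idCode n) w [ x ]) eq) ⟨
  codeWord (code n (w ++ [ x ])) ≈⟨ codeWord-code n ps ⟩
  w ++ [ x ]                  ∎)
  where open ≈-Reasoning
...   | inj₂ eq = inj₁ (reduced⇒minimal n (begin
  length (w ++ [ x ]) + sum (code n (w ++ [ x ])) ≡⟨ cong₂ _+_ (length-++ w) (cong sum (acts-++ (idCode n) w [ x ])) ⟩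
  (length w + 1) + sum (act x (code n w))         ≡⟨ +-assoc (length w) 1 _ ⟩
  length w + suc (sum (act x (code n w)))         ≡⟨ cong (length w +_) eq ⟩
  length w + sum (code n w)                       ≡⟨ minimal⇒reduced n (All.++⁻ˡ w ps) min ⟩
  sum (idCode n)                                  ∎))
  where open ≡-Reasoning

minimal-++ : ∀ w t → Minimal w → ∃[ t′ ] (Minimal (w ++ t′) × (w ++ t′) ≈H (w ++ t))
minimal-++ w [] min = [] , subst Minimal (sym (++-identityʳ w)) min , ≈-refl
minimal-++ w (x ∷ t) min with minimal-snoc x min
... | inj₁ min′ with minimal-++ (w ++ [ x ]) t min′
...   | t′ , m , e = x ∷ t′ , subst Minimal (++-assoc w [ x ] t′) m ,
                     subst₂ _≈H_ (++-assoc w [ x ] t′) (++-assoc w [ x ] t) e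
minimal-++ w (x ∷ t) min | inj₂ w≈wx with minimal-++ w t min
...   | t′ , m , e = t′ , m , (begin
  w ++ t′             ≈⟨ e ⟩
  w ++ t              ≈⟨ ++-congʳ t w≈wx ⟩
  (w ++ [ x ]) ++ t   ≡⟨ ++-assoc w [ x ] t ⟩
  w ++ x ∷ t          ∎)
  where open ≈-Reasoning

minimal-reverse : ∀ {w} → Minimal w → Minimal (reverse w)
minimal-reverse {w} min v v≈ = subst₂ _≤_ (sym (length-reverse w)) (length-reverse v)
  (min (reverse v) (subst (reverse v ≈H_) (reverse-involutive w) (reverse-cong v≈)))

minimal-++ˡ : ∀ u w → Minimal w → ∃[ u′ ] (Minimal (u′ ++ w) × (u′ ++ w) ≈H (u ++ w))
minimal-++ˡ u w min with minimal-++ (reverse w) (reverse u) (minimal-reverse min)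
... | t , m , e = reverse t ,
  subst Minimal eq (minimal-reverse m) ,
  subst₂ _≈H_ eq (trans (cong reverse (sym (reverse-++ u w))) (reverse-involutive (u ++ w))) (reverse-cong e)
  where
  eq : reverse (reverse w ++ t) ≡ reverse t ++ w
  eq = trans (reverse-++ (reverse w) t) (cong (reverse t ++_) (reverse-involutive w))

-- The size `2 + i` is the least that admits the letter `i + 1`. The leading entries `i + 2` and
-- `i + 1` both fall to `i`, a drop of three for three letters.
code-braid : ∀ i → code (2 + i) (i ∷ suc i ∷ i ∷ []) ≡ i ∷ i ∷ idCode i
code-braid i = begin
  act i (act (suc i) (act i (suc (suc i) ∷ suc i ∷ idCode i)))
    ≡⟨ cong (act i ∘ act (suc i)) (act-far (suc i ∷ idCode i) ≤-refl) ⟩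
  act i (act (suc i) (suc (suc i) ∷ act i (suc i ∷ idCode i)))
    ≡⟨ cong (act i) (act-extend (suc i) (act i (suc i ∷ idCode i))) ⟩
  act i (suc i ∷ act i (suc i ∷ idCode i))
    ≡⟨ act-extend i (act i (suc i ∷ idCode i)) ⟩
  i ∷ act i (suc i ∷ idCode i)
    ≡⟨ cong (i ∷_) (act-extend i (idCode i)) ⟩
  i ∷ i ∷ idCode i ∎
  where open ≡-Reasoning

braid-minimal : ∀ i → Minimal (i ∷ suc i ∷ i ∷ [])
braid-minimal i = reduced⇒minimal (2 + i) (begin
  3 + sum (code (2 + i) (i ∷ suc i ∷ i ∷ []))  ≡⟨ cong (λ c → 3 + sum c) (code-braid i) ⟩
  3 + (i + (i + sum (idCode i)))               ≡⟨ cong (λ k → 2 + k) (+-suc i (i + sum (idCode i))) ⟨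
  sum (idCode (2 + i))                         ∎)
  where open ≡-Reasoning

braid-minimal′ : ∀ i → Minimal (suc i ∷ i ∷ suc i ∷ [])
braid-minimal′ i v v≈ = braid-minimal i v (≈-trans v≈ (Eq.return (braid [] [] (suc i) i)))

minimal-context : ∀ u s t → Minimal s → ∃[ u′ ] ∃[ t′ ] (MinimalIn (u′ ++ s ++ t′) (u ++ s ++ t))
minimal-context u s t min with minimal-++ s t min
... | t′ , m , e with minimal-++ˡ u (s ++ t′) m
...   | u′ , m′ , e′ = u′ , t′ , eq , λ v v≈ → m′ v (≈-trans v≈ (≈-sym eq))
  where eq = ≈-trans e′ (++-congˡ u e)

-- Quantifying over the whole class, not only its shortest words, lets the property pass to factors:
-- a braid in a word equivalent to a factor sits in a word equivalent to the whole.
NoBraid : Word → Set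
NoBraid w = ∀ v → v ≈H w → ¬ ContainsBraid v

noBraid⇒fc : ∀ {w} → NoBraid w → FullyCommutative w
noBraid⇒fc nb v (v≈w , _) = nb v v≈w

-- A braid is a reduced word; adding the letters around it one at a time, each one either keeps
-- the word reduced or is absorbed, so the braid survives in some reduced word of the class.
fc⇒noBraid : ∀ {w} → FullyCommutative w → NoBraid w
fc⇒noBraid {w} fc v v≈w = λ
  { (u , t , i , inj₁ eq) → absurd u t (braid-minimal i) (λ u′ t′ → u′ , t′ , i , inj₁ refl) eq
  ; (u , t , i , inj₂ eq) → absurd u t (braid-minimal′ i) (λ u′ t′ → u′ , t′ , i , inj₂ refl) eq }
  where
  absurd : ∀ u t {s} → Minimal s → (∀ u′ t′ → ContainsBraid (u′ ++ s ++ t′)) → v ≡ u ++ s ++ t → ⊥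
  absurd u t {s} min bad refl =
    let u′ , t′ , eq , m = minimal-context u s t min in
    fc (u′ ++ s ++ t′) (≈-trans eq v≈w , λ v′ e → m v′ (≈-trans e (≈-sym v≈w))) (bad u′ t′)

noBraid-resp : ∀ {u v} → u ≈H v → NoBraid u → NoBraid v
noBraid-resp u≈v nb w w≈v = nb w (≈-trans w≈v (≈-sym u≈v))

noBraid-++ˡ : ∀ u {v} → NoBraid (u ++ v) → NoBraid u
noBraid-++ˡ u {v} nb w w≈u (a , t , i , e) =
  nb (w ++ v) (++-congʳ v w≈u) (a , t ++ v , i , Sum.map (λ { refl → ++-assoc a _ v }) (λ { refl → ++-assoc a _ v }) e)

noBraid-++ʳ : ∀ u {v} → NoBraid (u ++ v) → NoBraid v
noBraid-++ʳ u {v} nb w w≈v (a , t , i , e) =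
  nb (u ++ w) (++-congˡ u w≈v) (u ++ a , t , i ,
    Sum.map (λ { refl → sym (++-assoc u a _) }) (λ { refl → sym (++-assoc u a _) }) e)

noBraid-reverse : ∀ {w} → NoBraid w → NoBraid (reverse w)
noBraid-reverse {w} nb v v≈ (a , t , i , e) =
  nb (reverse v) (subst (reverse v ≈H_) (reverse-involutive w) (reverse-cong v≈))
    (reverse t , reverse a , i , Sum.map (λ { refl → reverse-split a (i ∷ suc i ∷ i ∷ []) t })
                                              (λ { refl → reverse-split a (suc i ∷ i ∷ suc i ∷ []) t }) e)

-- Strictly increasing rows

Sorted : List ℕ → Set
Sorted = AllPairs _<_

sorted-left : ∀ A {y B} → Sorted (A ++ y ∷ B) → All (_< y) A
sorted-left []      s        = []
sorted-left (a ∷ A) (ps ∷ s) = All.head (All.++⁻ʳ A ps) ∷ sorted-left A s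

sorted-right : ∀ A {y B} → Sorted (A ++ y ∷ B) → All (y <_) B
sorted-right []      (ps ∷ s) = ps
sorted-right (a ∷ A) (ps ∷ s) = sorted-right A s

sorted-++ˡ : ∀ A {B} → Sorted (A ++ B) → Sorted A
sorted-++ˡ []      s        = []
sorted-++ˡ (a ∷ A) (ps ∷ s) = All.++⁻ˡ A ps ∷ sorted-++ˡ A s

sorted-++ʳ : ∀ A {B} → Sorted (A ++ B) → Sorted B
sorted-++ʳ []      s       = s
sorted-++ʳ (_ ∷ A) (_ ∷ s) = sorted-++ʳ A s

sorted-∷ʳ : ∀ {A x} → Sorted A → All (_< x) A → Sorted (A ++ [ x ])
sorted-∷ʳ []       []       = [] ∷ []
sorted-∷ʳ (ps ∷ s) (p ∷ qs) = All.++⁺ ps (p ∷ []) ∷ sorted-∷ʳ s qs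

sorted-replace : ∀ A {x y B} → Sorted (A ++ y ∷ B) → All (_< x) A → All (x <_) B → Sorted (A ++ x ∷ B)
sorted-replace []      (_ ∷ s)  []       gt = gt ∷ s
sorted-replace (a ∷ A) (ps ∷ s) (p ∷ lt) gt =
  All.++⁺ (All.++⁻ˡ A ps) (p ∷ All.tail (All.++⁻ʳ A ps)) ∷ sorted-replace A s lt gt

∈-middle : ∀ A {y : ℕ} {B} → y ∈ A ++ y ∷ B
∈-middle A = ∈-++⁺ʳ A (here refl)

∈-split : ∀ A {x y : ℕ} {B} → x ∈ A ++ y ∷ B → x ∈ A ⊎ x ≡ y ⊎ x ∈ B
∈-split A x∈ with ∈-++⁻ A x∈
... | inj₁ p         = inj₁ p
... | inj₂ (here p)  = inj₂ (inj₁ p)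
... | inj₂ (there p) = inj₂ (inj₂ p)

data Located (x : ℕ) (R : List ℕ) : Set where
  gap : ∀ A B → R ≡ A ++ B → All (_< x) A → All (x <_) B → Located x R
  hit : ∀ A B → R ≡ A ++ x ∷ B → All (_< x) A → All (x <_) B → Located x R

locate : ∀ x {R} → Sorted R → Located x R
locate x [] = gap [] [] refl [] []
locate x {r ∷ R} (ps ∷ s) with <-cmp r x
... | tri≈ _ refl _ = hit [] R refl [] ps
... | tri> _ _ x<r  = gap [] (r ∷ R) refl [] (x<r ∷ All.map (<-trans x<r) ps)
... | tri< r<x _ _ with locate x s
...   | gap A B eq lt gt = gap (r ∷ A) B (cong (r ∷_) eq) (r<x ∷ lt) gt
...   | hit A B eq lt gt = hit (r ∷ A) B (cong (r ∷_) eq) (r<x ∷ lt) gt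

-- In both splittings the marked entry is the first one that is at least `x`.
split-unique : ∀ {x} A A′ {y y′ B B′} → A ++ y ∷ B ≡ A′ ++ y′ ∷ B′ →
               All (_< x) A → All (_< x) A′ → x ≤ y → x ≤ y′ → A ≡ A′ × y ≡ y′ × B ≡ B′
split-unique []      []        refl _        _        _  _   = refl , refl , refl
split-unique []      (a′ ∷ A′) refl _        (p ∷ _)  le _   = contradiction p (≤⇒≯ le)
split-unique (a ∷ A) []        refl (p ∷ _)  _        _  le  = contradiction p (≤⇒≯ le)
split-unique (a ∷ A) (a′ ∷ A′) eq   (_ ∷ ps) (_ ∷ qs) le le′
  with ∷-injective eq
... | refl , eq′ with split-unique A A′ eq′ ps qs le le′
...   | refl , eqs = refl , eqs

-- Row insertion as a relation

-- Maximality is phrased with `suc z ≡ y`, so that it is vacuous for `y = 0`.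
record IsRun (y x : ℕ) (R : List ℕ) : Set where
  constructor isRun
  field
    start≤end : y ≤ x
    filled    : ∀ {z} → y ≤ z → z ≤ x → z ∈ R
    maximal   : ∀ {z} → suc z ≡ y → z ∉ R

  start∈ : y ∈ R
  start∈ = filled ≤-refl start≤end

  end∈ : x ∈ R
  end∈ = filled start≤end ≤-refl

open IsRun

-- If `y < y′`, the predecessor of `y′` would lie in the run from `y` to `x`, against the maximality
-- of the other run.
run-start≤ : ∀ {y x R y′ x′} → IsRun y x R → IsRun y′ x′ R → y ≤ x′ → x′ ≤ x → y′ ≤ y
run-start≤ {y′ = zero}   r r′ p q = z≤n
run-start≤ {y = y} {y′ = suc z} r r′ p q with suc z ≤? y
... | yes le = le
... | no  gt = contradiction
  (filled r (≤-pred (≰⇒> gt)) (≤-trans (<⇒≤ (start≤end r′)) q)) (maximal r′ refl)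

run-start-unique : ∀ {y y′ x R} → IsRun y x R → IsRun y′ x R → y ≡ y′
run-start-unique r r′ =
  ≤-antisym (run-start≤ r′ r (start≤end r′) ≤-refl) (run-start≤ r r′ (start≤end r) ≤-refl)

-- The constructors are Cases 1, 2 and 3. In `replace`, both `x ∉ R` and the choice of `y` as the
-- smallest larger entry follow from `A < x < y` once `R` is sorted.
data RowIns (x : ℕ) (R : List ℕ) : RowResult → Set where
  append  : ∀ {R′} → R′ ≡ R ++ [ x ] → All (_< x) R → RowIns x R (appended R′)
  replace : ∀ A {y} B {R′} → R ≡ A ++ y ∷ B → R′ ≡ A ++ x ∷ B → All (_< x) A → x < y →
            RowIns x R (bumped R′ y)
  repeat  : ∀ {y} → IsRun y x R → RowIns x R (bumped R y)

resultRow : RowResult → List ℕ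
resultRow (appended R) = R
resultRow (bumped R _) = R

<ᵇ-true : ∀ {a b} → a < b → (a <ᵇ b) ≡ true
<ᵇ-true {a} {b} a<b with a <ᵇ b | <⇒<ᵇ a<b
... | true | _ = refl

<ᵇ-false : ∀ {a b} → b ≤ a → (a <ᵇ b) ≡ false
<ᵇ-false {a} {b} b≤a with a <ᵇ b | <ᵇ⇒< a b
... | false | _ = refl
... | true  | f = contradiction (f tt) (≤⇒≯ b≤a)

≡ᵇ-refl : ∀ a → (a ≡ᵇ a) ≡ true
≡ᵇ-refl zero    = refl
≡ᵇ-refl (suc a) = ≡ᵇ-refl a

≡ᵇ-false : ∀ {a b} → a ≢ b → (a ≡ᵇ b) ≡ false
≡ᵇ-false {a} {b} a≢b with a ≡ᵇ b | ≡ᵇ⇒≡ a b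
... | false | _ = refl
... | true  | f = contradiction (f tt) a≢b

∈ᵇ⇒∈ : ∀ {x} R → T (x ∈ᵇ R) → x ∈ R
∈ᵇ⇒∈ {x} R t = Any.map (≡ᵇ⇒≡ x _) (Any.any⁻ (x ≡ᵇ_) R t)

∈⇒∈ᵇ : ∀ {x R} → x ∈ R → T (x ∈ᵇ R)
∈⇒∈ᵇ {x} x∈ = Any.any⁺ (x ≡ᵇ_) (Any.map (≡⇒≡ᵇ x _) x∈)

≤-maxL : ∀ R → All (_≤ maxL R) R
≤-maxL []      = []
≤-maxL (r ∷ R) = m≤m⊔n r (maxL R) ∷ All.map (λ p → ≤-trans p (m≤n⊔m r (maxL R))) (≤-maxL R)

maxL-< : ∀ {x} R → 0 < x → All (_< x) R → maxL R < x
maxL-< []      0<x []       = 0<x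
maxL-< (r ∷ R) 0<x (p ∷ ps) = ⊔-pres-<m p (maxL-< R 0<x ps)

runStart-isRun : ∀ x {R} → x ∈ R → IsRun (runStart R x) x R
runStart-isRun zero x∈ = isRun ≤-refl (λ { _ z≤n → x∈ }) (λ ())
runStart-isRun (suc x) {R} x∈ with x ∈ᵇ R in eq
... | true = isRun (m≤n⇒m≤1+n (start≤end r)) filled′ (maximal r)
  where
  r = runStart-isRun x (∈ᵇ⇒∈ R (subst T (sym eq) tt))
  filled′ : ∀ {z} → runStart R x ≤ z → z ≤ suc x → z ∈ R
  filled′ p q with m≤n⇒m<n∨m≡n q
  ... | inj₁ (s≤s q′) = filled r p q′
  ... | inj₂ refl     = x∈
... | false = isRun ≤-refl (λ p q → subst (_∈ R) (≤-antisym p q) x∈)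
                (λ { refl z∈ → subst T eq (∈⇒∈ᵇ z∈) })

filter-below : ∀ {x} A {B} → All (_< x) A → filterᵇ (λ z → x <ᵇ z) (A ++ B) ≡ filterᵇ (λ z → x <ᵇ z) B
filter-below []      []       = refl
filter-below (a ∷ A) (p ∷ ps) rewrite <ᵇ-false (<⇒≤ p) = filter-below A ps

filter-above : ∀ {x} B → All (x <_) B → filterᵇ (λ z → x <ᵇ z) B ≡ B
filter-above []      []       = refl
filter-above (b ∷ B) (p ∷ ps) rewrite <ᵇ-true p = cong (b ∷_) (filter-above B ps)

minL-head : ∀ d {y} B → All (y <_) B → minL d (y ∷ B) ≡ y
minL-head d []      []       = refl
minL-head d {y} (b ∷ B) (p ∷ ps) rewrite minL-head d B ps | <ᵇ-false (<⇒≤ p) = refl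

substitute-id : ∀ x {y} A → All (_≢ y) A → map (λ z → if z ≡ᵇ y then x else z) A ≡ A
substitute-id x []      []       = refl
substitute-id x (a ∷ A) (p ∷ ps) rewrite ≡ᵇ-false p = cong (a ∷_) (substitute-id x A ps)

substitute-one : ∀ x {y} A {B} → All (_≢ y) A → All (_≢ y) B →
                 map (λ z → if z ≡ᵇ y then x else z) (A ++ y ∷ B) ≡ A ++ x ∷ B
substitute-one x {y} []      {B} []       qs rewrite ≡ᵇ-refl y = cong (x ∷_) (substitute-id x B qs)
substitute-one x     (a ∷ A) (p ∷ ps) qs rewrite ≡ᵇ-false p = cong (a ∷_) (substitute-one x A ps qs)

insertRow-correct : ∀ x {R} → Sorted R → RowIns x R (insertRow x R)
insertRow-correct x {[]} s = append refl []
insertRow-correct x {R@(_ ∷ _)} s with maxL R <ᵇ x in e₁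
... | true = append refl (All.map (λ p → ≤-<-trans p (<ᵇ⇒< (maxL R) x (subst T (sym e₁) tt))) (≤-maxL R))
... | false with x ∈ᵇ R in e₂
...   | true = repeat (runStart-isRun x (∈ᵇ⇒∈ R (subst T (sym e₂) tt)))
...   | false with locate x s
...     | hit A B eq _ _ = ⊥-elim (subst T e₂ (∈⇒∈ᵇ (subst (x ∈_) (sym eq) (∈-middle A))))
-- With `B` empty all of `R` lies below `x`, which the first test excluded. An entry of `R` below
-- `x` also gives `0 < x`, needed because `maxL` of the empty list is 0.
...     | gap A [] eq lt _ = ⊥-elim (subst T e₁ (<⇒<ᵇ (maxL-< R (≤-<-trans z≤n (All.head lt′)) lt′)))
  where
  lt′ : All (_< x) R
  lt′ = subst (All (_< x)) (sym (trans eq (++-identityʳ A))) lt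
...     | gap A (y ∷ B) eq lt (x<y ∷ gt) =
  subst (RowIns x R) (cong₂ bumped (sym row≡) (sym min≡)) (replace A B eq refl lt x<y)
  where
  s′ : Sorted (A ++ y ∷ B)
  s′ = subst Sorted eq s
  min≡ : minL x (filterᵇ (λ z → x <ᵇ z) R) ≡ y
  min≡ = begin
    minL x (filterᵇ (λ z → x <ᵇ z) R)             ≡⟨ cong (minL x ∘ filterᵇ (λ z → x <ᵇ z)) eq ⟩
    minL x (filterᵇ (λ z → x <ᵇ z) (A ++ y ∷ B))  ≡⟨ cong (minL x) (filter-below A lt) ⟩
    minL x (filterᵇ (λ z → x <ᵇ z) (y ∷ B))       ≡⟨ cong (minL x) (filter-above (y ∷ B) (x<y ∷ gt)) ⟩
    minL x (y ∷ B)                                ≡⟨ minL-head x B (sorted-right A s′) ⟩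
    y                                             ∎
    where open ≡-Reasoning
  row≡ : map (λ z → if z ≡ᵇ minL x (filterᵇ (λ z → x <ᵇ z) R) then x else z) R ≡ A ++ x ∷ B
  row≡ = trans (cong₂ (λ m L → map (λ z → if z ≡ᵇ m then x else z) L) min≡ eq)
    (substitute-one x A (All.map <⇒≢ (sorted-left A s′)) (All.map >⇒≢ (sorted-right A s′)))

gap∉ : ∀ {x y} A {B} → Sorted (A ++ y ∷ B) → All (_< x) A → x < y → x ∉ A ++ y ∷ B
gap∉ A s lt x<y x∈ with ∈-split A x∈
... | inj₁ p           = <-irrefl refl (All.lookup lt p)
... | inj₂ (inj₁ refl) = <-irrefl refl x<y
... | inj₂ (inj₂ p)    = <-asym x<y (All.lookup (sorted-right A s) p)

rowIns-deterministic : ∀ {x R r r′} → Sorted R → RowIns x R r → RowIns x R r′ → r ≡ r′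
rowIns-deterministic s (append refl _) (append refl _) = refl
rowIns-deterministic s (append _ lt) (replace A B refl _ _ x<y) =
  contradiction (All.lookup lt (∈-middle A)) (<-asym x<y)
rowIns-deterministic s (append _ lt) (repeat r) = contradiction (All.lookup lt (end∈ r)) (<-irrefl refl)
rowIns-deterministic s (replace A B refl _ _ x<y) (append _ lt) =
  contradiction (All.lookup lt (∈-middle A)) (<-asym x<y)
rowIns-deterministic s (replace A B refl refl lt p) (replace A′ B′ eq refl lt′ p′)
  with refl , refl , refl ← split-unique A A′ eq lt lt′ (<⇒≤ p) (<⇒≤ p′) = refl
rowIns-deterministic s (replace A B refl _ lt p) (repeat r) = contradiction (end∈ r) (gap∉ A s lt p)
rowIns-deterministic s (repeat r) (append _ lt) = contradiction (All.lookup lt (end∈ r)) (<-irrefl refl)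
rowIns-deterministic s (repeat r) (replace A B refl _ lt p) = contradiction (end∈ r) (gap∉ A s lt p)
rowIns-deterministic s (repeat r) (repeat r′) = cong (bumped _) (run-start-unique r r′)

insertRow-≡ : ∀ {x R r} → Sorted R → RowIns x R r → insertRow x R ≡ r
insertRow-≡ s ri = rowIns-deterministic s (insertRow-correct _ s) ri

rowIns-sorted : ∀ {x R r} → Sorted R → RowIns x R r → Sorted (resultRow r)
rowIns-sorted s (append refl lt) = sorted-∷ʳ s lt
rowIns-sorted s (replace A B refl refl lt p) =
  sorted-replace A s lt (All.map (<-trans p) (sorted-right A s))
rowIns-sorted s (repeat _) = s

inserted∈ : ∀ {x R r} → RowIns x R r → x ∈ resultRow r
inserted∈ {R = R} (append refl _) = ∈-middle R
inserted∈ (replace A B _ refl _ _) = ∈-middle A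
inserted∈ (repeat r) = end∈ r

bumped∈ : ∀ {x R R′ y} → RowIns x R (bumped R′ y) → y ∈ R
bumped∈ (replace A B refl _ _ _) = ∈-middle A
bumped∈ (repeat r) = start∈ r

length-bumped : ∀ {x R R′ y} → RowIns x R (bumped R′ y) → length R′ ≡ length R
length-bumped {x} {y = y} (replace A B refl refl _ _) =
  trans (length-++ A {x ∷ B}) (sym (length-++ A {y ∷ B}))
length-bumped (repeat _) = refl

-- Row insertion in the 0-Hecke monoid

-- The entries after `x` in `R` exceed `x + 1`, so the appended `x` commutes back to its copy and
-- merges with it.
rep-right : ∀ {x R} → Sorted R → x ∈ R → suc x ∉ R → (R ++ [ x ]) ≈H R
rep-right {x} s x∈ sx∉ with ∈-∃++ x∈
... | A , B , refl = begin
  (A ++ x ∷ B) ++ [ x ]   ≡⟨ ++-assoc A (x ∷ B) [ x ] ⟩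
  A ++ x ∷ B ++ [ x ]     ≈⟨ ++-congˡ A (++-congˡ [ x ] (commute-past B (All.tabulate far-B))) ⟨
  A ++ x ∷ x ∷ B          ≈⟨ Eq.return (idem A B x) ⟩
  A ++ x ∷ B              ∎
  where
  open ≈-Reasoning
  far-B : ∀ {b} → b ∈ B → Far x b
  far-B b∈ with m≤n⇒m<n∨m≡n (All.lookup (sorted-right A s) b∈)
  ... | inj₁ lt   = inj₁ lt
  ... | inj₂ refl = contradiction (∈-++⁺ʳ A (there b∈)) sx∉

rep-left : ∀ {y R} → Sorted R → y ∈ R → (∀ {z} → suc z ≡ y → z ∉ R) → (y ∷ R) ≈H R
rep-left {y} s y∈ py∉ with ∈-∃++ y∈
... | A , B , refl = begin
  y ∷ A ++ y ∷ B        ≈⟨ ++-congʳ (y ∷ B) (commute-past A (All.tabulate far-A)) ⟩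
  (A ++ [ y ]) ++ y ∷ B ≡⟨ ++-assoc A [ y ] (y ∷ B) ⟩
  A ++ y ∷ y ∷ B        ≈⟨ Eq.return (idem A B y) ⟩
  A ++ y ∷ B            ∎
  where
  open ≈-Reasoning
  far-A : ∀ {a} → a ∈ A → Far y a
  far-A a∈ with m≤n⇒m<n∨m≡n (All.lookup (sorted-left A s) a∈)
  ... | inj₁ lt = inj₂ lt
  ... | inj₂ eq = contradiction (∈-++⁺ˡ a∈) (py∉ eq)

adjacent : ∀ {x R} → Sorted R → x ∈ R → suc x ∈ R → ∃[ A ] ∃[ B ] R ≡ A ++ x ∷ suc x ∷ B
adjacent {x} s x∈ sx∈ with ∈-∃++ x∈
... | A , B , refl with ∈-split A sx∈
...   | inj₁ p        = contradiction (All.lookup (sorted-left A s) p) (<-asym ≤-refl)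
...   | inj₂ (inj₁ e) = contradiction e 1+n≢n
...   | inj₂ (inj₂ p) with sorted-++ʳ A s
...     | x< ∷ s′ with ∈-∃++ p
...       | []    , B′ , refl = A , B′ , refl
...       | b ∷ _ , B′ , refl =
  contradiction (All.head x<) (<⇒≱ (All.head (sorted-left (b ∷ _) s′)))

-- Otherwise the appended `x` commutes back until it follows `x (x+1)` and completes a braid. In
-- `pred∉` a prepended `y` moves right to the same effect.
suc∉ : ∀ {x R} → Sorted R → NoBraid (R ++ [ x ]) → x ∈ R → suc x ∉ R
suc∉ {x} s nb x∈ sx∈ with adjacent s x∈ sx∈
... | A , B , refl with sorted-++ʳ A s
...   | _ ∷ sx< ∷ _ = nb (A ++ x ∷ suc x ∷ x ∷ B) (begin
  A ++ x ∷ suc x ∷ x ∷ B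
    ≈⟨ ++-congˡ A (++-congˡ (x ∷ suc x ∷ []) (commute-past B (All.map inj₁ sx<))) ⟩
  A ++ x ∷ suc x ∷ B ++ [ x ]    ≡⟨ ++-assoc A (x ∷ suc x ∷ B) [ x ] ⟨
  (A ++ x ∷ suc x ∷ B) ++ [ x ]  ∎) (A , B , x , inj₁ refl)
  where open ≈-Reasoning

pred∉ : ∀ {y R} → Sorted R → NoBraid (y ∷ R) → y ∈ R → ∀ {z} → suc z ≡ y → z ∉ R
pred∉ s nb y∈ {z} refl z∈ with adjacent s z∈ y∈
... | A , B , refl = nb (A ++ suc z ∷ z ∷ suc z ∷ B) (begin
  A ++ suc z ∷ z ∷ suc z ∷ B      ≡⟨ ++-assoc A [ suc z ] (z ∷ suc z ∷ B) ⟨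
  (A ++ [ suc z ]) ++ z ∷ suc z ∷ B
    ≈⟨ ++-congʳ (z ∷ suc z ∷ B) (commute-past A (All.map (inj₂ ∘ s≤s) (sorted-left A s))) ⟨
  suc z ∷ A ++ z ∷ suc z ∷ B      ∎) (A , B , z , inj₂ refl)
  where open ≈-Reasoning

-- In `replace`, `x` lies strictly between `A` and `y`, and `y` strictly between `x` and `B`; hence
-- `x` is far from `B` and `y` far from `A`. In `repeat`, both sides collapse to `R`.
rowIns-≈ : ∀ {x R R′ y} → Sorted R → (x ∈ R → suc x ∉ R) → RowIns x R (bumped R′ y) →
           (R ++ [ x ]) ≈H (y ∷ R′)
rowIns-≈ {x} {y = y} s _ (replace A B refl refl lt x<y) = begin
  (A ++ y ∷ B) ++ [ x ]   ≡⟨ ++-assoc A (y ∷ B) [ x ] ⟩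
  A ++ y ∷ B ++ [ x ]
    ≈⟨ ++-congˡ A (++-congˡ [ y ] (commute-past B (All.map (inj₁ ∘ ≤-<-trans x<y) (sorted-right A s)))) ⟨
  A ++ y ∷ x ∷ B          ≡⟨ ++-assoc A [ y ] (x ∷ B) ⟨
  (A ++ [ y ]) ++ x ∷ B
    ≈⟨ ++-congʳ (x ∷ B) (commute-past A (All.map (λ a<x → inj₂ (≤-<-trans a<x x<y)) lt)) ⟨
  y ∷ A ++ x ∷ B          ∎
  where open ≈-Reasoning
rowIns-≈ s clear (repeat r) =
  ≈-trans (rep-right s (end∈ r) (clear (end∈ r))) (≈-sym (rep-left s (start∈ r) (maximal r)))

-- Reverse row insertion

-- Recovers the letter inserted in Case 3 from the bumped `y`: `go` walks right along the row while
-- the entries are consecutive.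
run-end : ∀ {y} A B → Sorted (A ++ y ∷ B) → (∀ {z} → suc z ≡ y → z ∉ A ++ y ∷ B) →
          ∃[ x ] (IsRun y x (A ++ y ∷ B) × suc x ∉ A ++ y ∷ B)
run-end {y} A B s start = go A B s ≤-refl (λ p q → subst (_∈ A ++ y ∷ B) (≤-antisym p q) (∈-middle A)) start
  where
  go : ∀ {y x} A B → Sorted (A ++ x ∷ B) → y ≤ x →
       (∀ {z} → y ≤ z → z ≤ x → z ∈ A ++ x ∷ B) → (∀ {z} → suc z ≡ y → z ∉ A ++ x ∷ B) →
       ∃[ x′ ] (IsRun y x′ (A ++ x ∷ B) × suc x′ ∉ A ++ x ∷ B)
  go {y} {x} A B s y≤x fill start with suc x ∈? A ++ x ∷ B
  ... | no  sx∉ = x , isRun y≤x fill start , sx∉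
  go {y} {x} A [] s y≤x fill start | yes sx∈ with ∈-split A sx∈
  ... | inj₁ p        = contradiction (All.lookup (sorted-left A s) p) (<-asym ≤-refl)
  ... | inj₂ (inj₁ e) = contradiction e 1+n≢n
  go {y} {x} A (b ∷ B) s y≤x fill start | yes sx∈ with adjacent s (∈-middle A) sx∈
  ... | A′ , B′ , eq with split-unique A A′ eq (sorted-left A s) (sorted-left A′ (subst Sorted eq s)) ≤-refl ≤-refl
  ... | refl , _ , refl =
    subst (λ R → ∃[ x′ ] (IsRun y x′ R × suc x′ ∉ R)) assoc
      (go (A ++ [ x ]) B (subst Sorted (sym assoc) s) (m≤n⇒m≤1+n y≤x)
        (λ p q → subst (_ ∈_) (sym assoc) (fill′ p (m≤n⇒m<n∨m≡n q)))
        (λ e z∈ → start e (subst (_ ∈_) assoc z∈)))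
    where
    assoc : (A ++ [ x ]) ++ suc x ∷ B ≡ A ++ x ∷ suc x ∷ B
    assoc = ++-assoc A [ x ] (suc x ∷ B)
    fill′ : ∀ {z} → y ≤ z → z < suc x ⊎ z ≡ suc x → z ∈ A ++ x ∷ suc x ∷ B
    fill′ p (inj₁ (s≤s q)) = fill p q
    fill′ p (inj₂ refl)    = sx∈

record RowPreimage (R′ : List ℕ) (y : ℕ) : Set where
  constructor rowPreimage
  field
    {letter} : ℕ
    {row}    : List ℕ
    rowIns   : RowIns letter row (bumped R′ y)
    sorted   : Sorted row
    clear    : letter ∈ row → suc letter ∉ row

-- Membership of `y` in `R′` tells Case 3 from Case 2. In Case 2 the inserted letter was the largest
-- entry below `y`; the entry `a`, which `insert-below` obtains from the column condition,
-- guarantees that there is one.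
reverse-rowIns : ∀ {y a R′} → Sorted R′ → a ∈ R′ → a ≤ y → NoBraid (y ∷ R′) → RowPreimage R′ y
reverse-rowIns {y} s a∈ a≤y nb with locate y s
... | hit A B refl _ _ =
  let x , r , sx∉ = run-end A B s (pred∉ s nb (∈-middle A))
  in rowPreimage (repeat r) s (λ _ → sx∉)
... | gap A B refl lt gt with initLast A
...   | [] = contradiction (All.lookup gt a∈) (≤⇒≯ a≤y)
...   | A₀ ∷ʳ′ x =
  rowPreimage (replace A₀ B refl (++-assoc A₀ [ x ] B) lt₀ x<y)
    (sorted-replace A₀ s′ (All.++⁻ˡ A₀ lt) gt)
    (λ x∈ → contradiction x∈ (gap∉ A₀ (sorted-replace A₀ s′ (All.++⁻ˡ A₀ lt) gt) lt₀ x<y))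
  where
  s′ : Sorted (A₀ ++ x ∷ B)
  s′ = subst Sorted (++-assoc A₀ [ x ] B) s
  lt₀ : All (_< x) A₀
  lt₀ = sorted-left A₀ s′
  x<y : x < y
  x<y = All.head (All.++⁻ʳ A₀ lt)

run-end-unique : ∀ {y x x′ R} → IsRun y x R → IsRun y x′ R → suc x ∉ R → x′ ≤ x
run-end-unique {x = x} {x′} r r′ sx∉ with x′ ≤? x
... | yes le = le
... | no  gt = contradiction (filled r′ (m≤n⇒m≤1+n (start≤end r)) (≰⇒> gt)) sx∉

bumped∉ : ∀ {x y} A {B} → Sorted (A ++ y ∷ B) → All (_< x) A → x < y → y ∉ A ++ x ∷ B
bumped∉ A s lt x<y y∈ with ∈-split A y∈
... | inj₁ p           = <-asym x<y (All.lookup lt p)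
... | inj₂ (inj₁ refl) = <-irrefl refl x<y
... | inj₂ (inj₂ p)    = <-irrefl refl (All.lookup (sorted-right A s) p)

replaced-largest : ∀ {x x′ y} A {B} → Sorted (A ++ y ∷ B) → All (_< x) A → x′ < y → x′ ∈ A ++ x ∷ B → x′ ≤ x
replaced-largest A s lt x′<y x′∈ with ∈-split A x′∈
... | inj₁ p           = <⇒≤ (All.lookup lt p)
... | inj₂ (inj₁ refl) = ≤-refl
... | inj₂ (inj₂ p)    = contradiction (All.lookup (sorted-right A s) p) (<-asym x′<y)

-- After Case 2 the bumped `y` is absent from `R′`, after Case 3 it is present. In Case 2, `x` is
-- the largest entry of `R′` below `y`; in Case 3, it is the end of the run from `y`, by the two
-- hypotheses on successors.
rowIns-injective : ∀ {x x′ R S R′ y} → Sorted R → Sorted S → (x ∈ R → suc x ∉ R) → (x′ ∈ S → suc x′ ∉ S) →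
                   RowIns x R (bumped R′ y) → RowIns x′ S (bumped R′ y) → x ≡ x′ × R ≡ S
rowIns-injective s s′ _ _ (replace A B refl refl lt p) (replace A′ B′ refl eq lt′ p′)
  with ≤-antisym (replaced-largest A′ s′ lt′ p (subst (_ ∈_) eq (∈-middle A)))
                 (replaced-largest A s lt p′ (subst (_ ∈_) (sym eq) (∈-middle A′)))
... | refl with refl , _ , refl ← split-unique A A′ eq lt lt′ ≤-refl ≤-refl = refl , refl
rowIns-injective s _ _ _ (replace A B refl refl lt p) (repeat r) = contradiction (start∈ r) (bumped∉ A s lt p)
rowIns-injective _ s _ _ (repeat r) (replace A B refl refl lt p) = contradiction (start∈ r) (bumped∉ A s lt p)
rowIns-injective _ _ c c′ (repeat r) (repeat r′) =
  ≤-antisym (run-end-unique r′ r (c′ (end∈ r′))) (run-end-unique r r′ (c (end∈ r))) , refl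

-- Comparing two successive insertions

insert-≤-bumps : ∀ {x x′ R r R″} → x′ ≤ x → RowIns x R r → ¬ RowIns x′ (resultRow r) (appended R″)
insert-≤-bumps le ri (append _ lt) = ≤⇒≯ le (All.lookup lt (inserted∈ ri))

-- If the first insertion replaces `y`, then `x ∈ R′` and `y′ ≤ x < y`. If it repeats, the run from
-- `y` to `x` stays in the row: an `x′` inside it bumps the start of that run, and an `x′` below it
-- bumps at most `y`.
bumped-≤ : ∀ {x x′ R R′ R″ y y′} → Sorted R → x′ ≤ x →
           RowIns x R (bumped R′ y) → RowIns x′ R′ (bumped R″ y′) → y′ ≤ y
bumped-≤ {x} s le ri@(replace _ _ _ _ _ x<y) (replace A B eq _ lt p) = ≤-trans y′≤x (<⇒≤ x<y)
  where
  y′≤x : _ ≤ x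
  y′≤x with ∈-split A (subst (x ∈_) eq (inserted∈ ri))
  ... | inj₁ q           = contradiction (All.lookup lt q) (≤⇒≯ le)
  ... | inj₂ (inj₁ refl) = ≤-refl
  ... | inj₂ (inj₂ q)    = <⇒≤ (All.lookup (sorted-right A (subst Sorted eq (rowIns-sorted s ri))) q)
bumped-≤ s le (replace _ _ _ _ _ x<y) (repeat r) = ≤-trans (start≤end r) (≤-trans le (<⇒≤ x<y))
bumped-≤ {x′ = x′} {y = y} s le (repeat r) (replace A B refl _ lt p) with y ≤? x′
... | yes y≤x′ = contradiction (filled r y≤x′ le) (gap∉ A s lt p)
... | no  x′<y with ∈-split A (start∈ r)
...   | inj₁ q           = contradiction (All.lookup lt q) (<-asym (≰⇒> x′<y))
...   | inj₂ (inj₁ refl) = ≤-refl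
...   | inj₂ (inj₂ q)    = <⇒≤ (All.lookup (sorted-right A s) q)
bumped-≤ {x′ = x′} {y = y} s le (repeat r) (repeat r′) with y ≤? x′
... | yes y≤x′ = run-start≤ r r′ y≤x′ le
... | no  x′<y = ≤-trans (start≤end r′) (<⇒≤ (≰⇒> x′<y))

insert-<-appends : ∀ {x x′ R R′ R″ y} → x < x′ → RowIns x R (appended R′) → ¬ RowIns x′ R′ (bumped R″ y)
insert-<-appends {x} {x′} {R} lt (append refl lt₁) = λ
  { (replace A B eq _ _ p) → <-asym p (All.lookup below (subst (_ ∈_) (sym eq) (∈-middle A)))
  ; (repeat r)             → <-irrefl refl (All.lookup below (end∈ r)) }
  where
  below : All (_< x′) (R ++ [ x ])
  below = All.++⁺ (All.map (λ p → <-trans p lt) lt₁) (lt ∷ [])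

-- A replacement leaves no entry `z` with `x < z ≤ y`, so neither a larger entry nor a run that ends
-- above `x` can bump anything down to `y`. If both insertions repeat, `y′ ≤ y` would put `x + 1`
-- into the row; here strictness rests on full commutativity.
bumped-< : ∀ {x x′ R R′ R″ y y′} → Sorted R → (x ∈ R → suc x ∉ R) → x < x′ →
           RowIns x R (bumped R′ y) → RowIns x′ R′ (bumped R″ y′) → y < y′
bumped-< {x} {x′} {y = y} s _ lt (replace A B refl refl ltA p) = λ
  { (replace A′ B′ eq _ _ q) → above (<-trans lt q) (subst (_ ∈_) (sym eq) (∈-middle A′))
  ; (repeat r) → ≰⇒> (λ y′≤y → bumped∉ A s ltA p (filled r y′≤y (<⇒≤ (above lt (end∈ r))))) }
  where
  above : ∀ {z} → x < z → z ∈ A ++ x ∷ B → y < z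
  above x<z z∈ with ∈-split A z∈
  ... | inj₁ q           = contradiction (All.lookup ltA q) (<-asym x<z)
  ... | inj₂ (inj₁ refl) = contradiction x<z (<-irrefl refl)
  ... | inj₂ (inj₂ q)    = All.lookup (sorted-right A s) q
bumped-< s _ lt (repeat r) (replace _ _ _ _ _ q) = ≤-<-trans (start≤end r) (<-trans lt q)
bumped-< s clear lt (repeat r) (repeat r′) =
  ≰⇒> (λ y′≤y → clear (end∈ r) (filled r′ (m≤n⇒m≤1+n (≤-trans y′≤y (start≤end r))) lt))

-- Columns of adjacent rows

col-length : ∀ {_∼_ R S} → ColRel _∼_ R S → length S ≤ length R
col-length done       = z≤n
col-length (step _ c) = s≤s (col-length c)

col-extend : ∀ {_∼_ R S} X → ColRel _∼_ R S → ColRel _∼_ (R ++ X) S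
col-extend X done       = done
col-extend X (step p c) = step p (col-extend X c)

col-unextend : ∀ {_∼_} R {X S} → length S ≤ length R → ColRel _∼_ (R ++ X) S → ColRel _∼_ R S
col-unextend []      {S = []} _ c        = done
col-unextend (_ ∷ R) le       done       = done
col-unextend (_ ∷ R) (s≤s le) (step p c) = step p (col-unextend R le c)

col-unappend : ∀ {_∼_ R} S {X} → ColRel _∼_ R (S ++ X) → ColRel _∼_ R S
col-unappend []      c          = done
col-unappend (_ ∷ S) (step p c) = step p (col-unappend S c)

-- An entry of `R` under a cell of `S` is less than `y`. Hence `y` occurs in `R` no further left
-- than the new cell, and the entry under that cell is at most `y`.
col-append : ∀ {y R S} → Sorted R → y ∈ R → All (_< y) S → ColRel _≤_ R S → ColRel _≤_ R (S ++ [ y ])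
col-append {R = _ ∷ _} (a< ∷ s) (here refl) _  done = step ≤-refl done
col-append {R = _ ∷ _} (a< ∷ s) (there y∈)  _  done = step (<⇒≤ (All.lookup a< y∈)) done
col-append (a< ∷ s) (here refl) (b<y ∷ _)  (step p c) = contradiction b<y (≤⇒≯ p)
col-append (a< ∷ s) (there y∈)  (_ ∷ lt)   (step p c) = step p (col-append s y∈ lt c)

col-replace : ∀ {y R} A {z B} → Sorted R → y ∈ R → All (_< y) A →
              ColRel _≤_ R (A ++ z ∷ B) → ColRel _≤_ R (A ++ y ∷ B)
col-replace []      (a< ∷ s) (here refl) _         (step p c) = step ≤-refl c
col-replace []      (a< ∷ s) (there y∈)  _         (step p c) = step (<⇒≤ (All.lookup a< y∈)) c
col-replace (_ ∷ A) (a< ∷ s) (here refl) (b<y ∷ _) (step p c) = contradiction b<y (≤⇒≯ p)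
col-replace (_ ∷ A) (a< ∷ s) (there y∈)  (_ ∷ lt)  (step p c) = step p (col-replace A s y∈ lt c)

col-rowIns : ∀ {y R S r} → Sorted R → y ∈ R → RowIns y S r → ColRel _≤_ R S → ColRel _≤_ R (resultRow r)
col-rowIns s y∈ (append refl lt)             c = col-append s y∈ lt c
col-rowIns s y∈ (replace A B refl refl lt _) c = col-replace A s y∈ lt c
col-rowIns s y∈ (repeat _)                   c = c

col-lower : ∀ {x y} A {B S} → x ≤ y → ColRel _≤_ (A ++ y ∷ B) S → ColRel _≤_ (A ++ x ∷ B) S
col-lower []      le done       = done
col-lower (_ ∷ A) le done       = done
col-lower []      le (step p c) = step (≤-trans le p) c
col-lower (_ ∷ A) le (step p c) = step p (col-lower A le c)

rowIns-lowers : ∀ {x R R′ y S} → RowIns x R (bumped R′ y) → ColRel _≤_ R S → ColRel _≤_ R′ S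
rowIns-lowers (replace A B refl refl _ p) c = col-lower A (<⇒≤ p) c
rowIns-lowers (repeat _)                  c = c

col-below : ∀ {R S y} → ColRel _≤_ R S → y ∈ S → ∃[ a ] (a ∈ R × a ≤ y)
col-below (step p c) (here refl) = _ , here refl , p
col-below (step p c) (there y∈)  = let a , a∈ , le = col-below c y∈ in a , there a∈ , le

-- All of `B` exceeds `y`, so the `y` of `S` stands over `A` or over `x`, and the entry over the
-- raised cell is at least `y`. The second alternative is the state after that `y` has been passed.
col-raise : ∀ {x y} A {B S} → Sorted S → y ∈ S ⊎ All (y <_) S → All (y <_) B →
            ColRel _≤_ (A ++ x ∷ B) S → ColRel _≤_ (A ++ y ∷ B) S
col-raise []      s        h                  gt done       = done
col-raise (_ ∷ A) s        h                  gt done       = done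
col-raise []      s        (inj₁ (here refl)) gt (step p c) = step ≤-refl c
col-raise []      s        (inj₁ (there y∈))  gt (step p c) =
  let _ , a∈ , le = col-below c y∈ in contradiction (All.lookup gt a∈) (≤⇒≯ le)
col-raise []      s        (inj₂ (y< ∷ _))    gt (step p c) = step (<⇒≤ y<) c
col-raise (_ ∷ A) (y< ∷ s) (inj₁ (here refl)) gt (step p c) = step p (col-raise A s (inj₂ y<) gt c)
col-raise (_ ∷ A) (_ ∷ s)  (inj₁ (there y∈))  gt (step p c) = step p (col-raise A s (inj₁ y∈) gt c)
col-raise (_ ∷ A) (_ ∷ s)  (inj₂ (_ ∷ y<))    gt (step p c) = step p (col-raise A s (inj₂ y<) gt c)

rowIns-raises : ∀ {x R R′ y S} → Sorted R → Sorted S → y ∈ S → RowIns x R (bumped R′ y) →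
                ColRel _≤_ R′ S → ColRel _≤_ R S
rowIns-raises s s′ y∈ (replace A B refl refl _ _) c = col-raise A s′ (inj₁ y∈) (sorted-right A s) c
rowIns-raises s s′ y∈ (repeat _)                  c = c

col-unreplace : ∀ {R y z} A {B} → y ≤ z → ColRel _≤_ R (A ++ y ∷ B) → ColRel _≤_ R (A ++ z ∷ B)
col-unreplace []      le (step p c) = step (≤-trans p le) c
col-unreplace (_ ∷ A) le (step p c) = step p (col-unreplace A le c)

col-rowIns⁻ : ∀ {y R S r} → RowIns y S r → ColRel _≤_ R (resultRow r) → ColRel _≤_ R S
col-rowIns⁻ {S = S} (append refl _)         c = col-unappend S c
col-rowIns⁻ (replace A B refl refl _ p)     c = col-unreplace A (<⇒≤ p) c
col-rowIns⁻ (repeat _)                      c = c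

-- Tableau insertion as a relation

-- `NonEmpty` in `stop` separates opening a new row from appending to an existing one.
data Insert : ℕ → Tableau → Tableau → ℕ → Set where
  new  : ∀ {x} → Insert x [] ([ x ] ∷ []) 0
  stop : ∀ {x R R′ Rs} → NonEmpty R → RowIns x R (appended R′) → Insert x (R ∷ Rs) (R′ ∷ Rs) 0
  up   : ∀ {x y i R R′ Rs Rs′} → RowIns x R (bumped R′ y) → Insert y Rs Rs′ i →
         Insert x (R ∷ Rs) (R′ ∷ Rs′) (suc i)

insertP-correct : ∀ x {P} → All NonEmpty P → All Sorted P →
                  Insert x P (proj₁ (insertP x P)) (proj₂ (insertP x P))
insertP-correct x [] [] = new
insertP-correct x {R ∷ Rs} (ne ∷ nes) (s ∷ ss) with insertRow x R | insertRow-correct x s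
... | appended R′ | ri = stop ne ri
... | bumped R′ y | ri = up ri (insertP-correct y nes ss)

insertP-≡ : ∀ {x P P′ i} → All Sorted P → Insert x P P′ i → insertP x P ≡ (P′ , i)
insertP-≡ [] new = refl
insertP-≡ (s ∷ ss) (stop _ ri) rewrite insertRow-≡ s ri = refl
insertP-≡ (s ∷ ss) (up ri ins) rewrite insertRow-≡ s ri | insertP-≡ ss ins = refl

insert-sorted : ∀ {x P P′ i} → All Sorted P → Insert x P P′ i → All Sorted P′
insert-sorted []       new         = ([] ∷ []) ∷ []
insert-sorted (s ∷ ss) (stop _ ri) = rowIns-sorted s ri ∷ ss
insert-sorted (s ∷ ss) (up ri ins) = rowIns-sorted s ri ∷ insert-sorted ss ins

Cols : Tableau → Set
Cols = Linked (ColRel _≤_)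

linked-map-head : ∀ {A : Set} {_∼_ : A → A → Set} {a b l} → (∀ {c} → a ∼ c → b ∼ c) →
                  Linked _∼_ (a ∷ l) → Linked _∼_ (b ∷ l)
linked-map-head f [-]     = [-]
linked-map-head f (p ∷ l) = f p ∷ l

-- The upper rows are compared with the row before its change, which still contains the bumped `y`.
-- Its entries only decrease afterwards, and `rowIns-lowers` accounts for that.
insert-cols-above : ∀ {y i R Rs Rs′} → Sorted R → All Sorted Rs → y ∈ R → Insert y Rs Rs′ i →
                    Cols (R ∷ Rs) → Cols (R ∷ Rs′)
insert-cols-above s []       y∈ new         [-] = col-append s y∈ [] done ∷ [-]
insert-cols-above s (t ∷ ts) y∈ (stop _ ri@(append refl _)) (c ∷ l) =
  col-rowIns s y∈ ri c ∷ linked-map-head (col-extend _) l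
insert-cols-above s (t ∷ ts) y∈ (up ri ins) (c ∷ l) =
  col-rowIns s y∈ ri c ∷ linked-map-head (rowIns-lowers ri) (insert-cols-above t ts (bumped∈ ri) ins l)

insert-cols : ∀ {x P P′ i} → All Sorted P → Insert x P P′ i → Cols P → Cols P′
insert-cols []       new         []  = [-]
insert-cols (s ∷ ss) (stop _ (append refl _)) l = linked-map-head (col-extend _) l
insert-cols (s ∷ ss) (up ri ins) l =
  linked-map-head (rowIns-lowers ri) (insert-cols-above s ss (bumped∈ ri) ins l)

nonEmpty-++ : ∀ R {x X} → NonEmpty (R ++ x ∷ X)
nonEmpty-++ []      = tt
nonEmpty-++ (_ ∷ _) = tt

nonEmpty-resp-length : ∀ {R S} → length R ≡ length S → NonEmpty R → NonEmpty S
nonEmpty-resp-length {_ ∷ _} {_ ∷ _} _ _ = tt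

nonEmpty-resp-shape : ∀ {P Q} → shape P ≡ shape Q → All NonEmpty P → All NonEmpty Q
nonEmpty-resp-shape {[]}    {[]}    _  []         = []
nonEmpty-resp-shape {_ ∷ _} {_ ∷ _} eq (ne ∷ nes) =
  nonEmpty-resp-length (∷-injectiveˡ eq) ne ∷ nonEmpty-resp-shape (∷-injectiveʳ eq) nes

insert-nonEmpty : ∀ {x P P′ i} → All NonEmpty P → Insert x P P′ i → All NonEmpty P′
insert-nonEmpty []         new = tt ∷ []
insert-nonEmpty (ne ∷ nes) (stop {R = R} _ (append refl _)) = nonEmpty-++ R ∷ nes
insert-nonEmpty (ne ∷ nes) (up ri ins) =
  nonEmpty-resp-length (sym (length-bumped ri)) ne ∷ insert-nonEmpty nes ins

rowWord-∷ : ∀ R Rs → rowWord (R ∷ Rs) ≡ rowWord Rs ++ R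
rowWord-∷ R Rs = begin
  concat (reverse (R ∷ Rs))            ≡⟨ cong concat (unfold-reverse R Rs) ⟩
  concat (reverse Rs ++ [ R ])         ≡⟨ concat-++ (reverse Rs) [ R ] ⟨
  rowWord Rs ++ R ++ []                ≡⟨ cong (rowWord Rs ++_) (++-identityʳ R) ⟩
  rowWord Rs ++ R                      ∎
  where open ≡-Reasoning

rowWord-∷ʳ : ∀ x R Rs → rowWord (R ∷ Rs) ++ [ x ] ≡ rowWord Rs ++ (R ++ [ x ])
rowWord-∷ʳ x R Rs = trans (cong (_++ [ x ]) (rowWord-∷ R Rs)) (++-assoc (rowWord Rs) R [ x ])

module _ {x y R R′} (Rs : Tableau) (eq : (R ++ [ x ]) ≈H (y ∷ R′)) where

  rowWord-bump : (rowWord (R ∷ Rs) ++ [ x ]) ≈H ((rowWord Rs ++ [ y ]) ++ R′)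
  rowWord-bump = begin
    rowWord (R ∷ Rs) ++ [ x ]    ≡⟨ rowWord-∷ʳ x R Rs ⟩
    rowWord Rs ++ (R ++ [ x ])   ≈⟨ ++-congˡ (rowWord Rs) eq ⟩
    rowWord Rs ++ y ∷ R′         ≡⟨ ++-assoc (rowWord Rs) [ y ] R′ ⟨
    (rowWord Rs ++ [ y ]) ++ R′  ∎
    where open ≈-Reasoning

  rowWord-up : ∀ Rs′ → (rowWord Rs ++ [ y ]) ≈H rowWord Rs′ → (rowWord (R ∷ Rs) ++ [ x ]) ≈H rowWord (R′ ∷ Rs′)
  rowWord-up Rs′ eq′ = begin
    rowWord (R ∷ Rs) ++ [ x ]    ≈⟨ rowWord-bump ⟩
    (rowWord Rs ++ [ y ]) ++ R′  ≈⟨ ++-congʳ R′ eq′ ⟩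
    rowWord Rs′ ++ R′            ≡⟨ rowWord-∷ R′ Rs′ ⟨
    rowWord (R′ ∷ Rs′)           ∎
    where open ≈-Reasoning

row-clear : ∀ {x R} Rs → Sorted R → NoBraid (rowWord (R ∷ Rs) ++ [ x ]) → x ∈ R → suc x ∉ R
row-clear {x} {R} Rs s nb = suc∉ s (noBraid-++ʳ (rowWord Rs) (subst NoBraid (rowWord-∷ʳ x R Rs) nb))

-- The bump carries `y` to the left of the row, so the word of the next insertion is a prefix of an
-- equivalent word.
noBraid-up : ∀ {x y R R′} Rs → Sorted R → NoBraid (rowWord (R ∷ Rs) ++ [ x ]) → RowIns x R (bumped R′ y) →
             NoBraid (rowWord Rs ++ [ y ])
noBraid-up {y = y} Rs s nb ri =
  noBraid-++ˡ (rowWord Rs ++ [ y ])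
    (noBraid-resp (rowWord-bump Rs (rowIns-≈ s (row-clear Rs s nb) ri)) nb)

insert-≈ : ∀ {x P P′ i} → All Sorted P → NoBraid (rowWord P ++ [ x ]) → Insert x P P′ i →
           (rowWord P ++ [ x ]) ≈H rowWord P′
insert-≈ [] nb new = ≈-refl
insert-≈ (s ∷ ss) nb (stop {x} {R} {Rs = Rs} _ (append refl _)) =
  ≈-reflexive (trans (rowWord-∷ʳ x R Rs) (sym (rowWord-∷ (R ++ [ x ]) Rs)))
insert-≈ (s ∷ ss) nb (up {Rs = Rs} {Rs′} ri ins) =
  rowWord-up Rs (rowIns-≈ s (row-clear Rs s nb) ri) Rs′ (insert-≈ ss (noBraid-up Rs s nb ri) ins)

-- The comparison passes to the bumped letters, and a weakly smaller letter is never appended to a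
-- row that the other has just entered.
pieri-≤ : ∀ {x x′ P P′ P″ i i′} → All Sorted P → x′ ≤ x → Insert x P P′ i → Insert x′ P′ P″ i′ → i < i′
pieri-≤ _ le new (stop _ ri) = contradiction ri (insert-≤-bumps le (append {R = []} refl []))
pieri-≤ _ le new (up _ _) = s≤s z≤n
pieri-≤ _ le (stop _ ri) (stop _ ri′) = contradiction ri′ (insert-≤-bumps le ri)
pieri-≤ _ le (stop _ ri) (up _ _) = s≤s z≤n
pieri-≤ _ le (up ri _) (stop _ ri′) = contradiction ri′ (insert-≤-bumps le ri)
pieri-≤ (s ∷ ss) le (up ri ins) (up ri′ ins′) = s≤s (pieri-≤ ss (bumped-≤ s le ri ri′) ins ins′)

pieri-< : ∀ {x x′ P P′ P″ i i′} → All Sorted P → NoBraid (rowWord P ++ [ x ]) → x < x′ →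
          Insert x P P′ i → Insert x′ P′ P″ i′ → i′ ≤ i
pieri-< _ nb lt _ (stop _ _) = z≤n
pieri-< _ nb lt new (up ri′ _) = contradiction ri′ (insert-<-appends lt (append {R = []} refl []))
pieri-< _ nb lt (stop _ ri) (up ri′ _) = contradiction ri′ (insert-<-appends lt ri)
pieri-< (s ∷ ss) nb lt (up {Rs = Rs} ri ins) (up ri′ ins′) =
  s≤s (pieri-< ss (noBraid-up Rs s nb ri) (bumped-< s (row-clear Rs s nb) lt ri ri′) ins ins′)

insert-injective : ∀ {x x′ P S P′ i} → All Sorted P → All Sorted S →
                   NoBraid (rowWord P ++ [ x ]) → NoBraid (rowWord S ++ [ x′ ]) →
                   Insert x P P′ i → Insert x′ S P′ i → x ≡ x′ × P ≡ S
insert-injective _ _ _ _ new new = refl , refl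
insert-injective _ _ _ _ new (stop {R = _ ∷ []} _ (append () _))
insert-injective _ _ _ _ new (stop {R = _ ∷ _ ∷ _} _ (append () _))
insert-injective _ _ _ _ (stop {R = _ ∷ []} _ (append () _)) new
insert-injective _ _ _ _ (stop {R = _ ∷ _ ∷ _} _ (append () _)) new
insert-injective _ _ _ _ (stop {R = R} _ (append refl _)) (stop {R = S} _ (append eq _))
  with refl , refl ← ∷ʳ-injective R S eq = refl , refl
insert-injective (s ∷ ss) (t ∷ ts) nb nb′ (up {Rs = Rs} ri ins) (up {Rs = Ss} ri′ ins′)
  with refl , refl ← insert-injective ss ts (noBraid-up Rs s nb ri) (noBraid-up Ss t nb′ ri′) ins ins′
  with refl , refl ← rowIns-injective s t (row-clear Rs s nb) (row-clear Ss t nb′) ri ri′ = refl , refl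

-- Recording tableaux

data AddCell (q : ℕ) : ℕ → Tableau → Tableau → Set where
  new  : AddCell q 0 [] ([ q ] ∷ [])
  stop : ∀ {r rs} → NonEmpty r → AddCell q 0 (r ∷ rs) ((r ++ [ q ]) ∷ rs)
  up   : ∀ {i r rs rs′} → AddCell q i rs rs′ → AddCell q (suc i) (r ∷ rs) (r ∷ rs′)

addCell-≡ : ∀ {q i Q Q′} → AddCell q i Q Q′ → addCell q i Q ≡ Q′
addCell-≡ new      = refl
addCell-≡ (stop _) = refl
addCell-≡ (up ac)  = cong (_ ∷_) (addCell-≡ ac)

length-∷ʳ : ∀ {A : Set} (R : List A) {x} → length (R ++ [ x ]) ≡ suc (length R)
length-∷ʳ R = trans (length-++ R) (+-comm (length R) 1)

insert-addCell : ∀ q {x P P′ Q i} → Insert x P P′ i → shape P ≡ shape Q →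
                 AddCell q i Q (addCell q i Q) × shape P′ ≡ shape (addCell q i Q)
insert-addCell q {Q = []} new _ = new , refl
insert-addCell q {Q = r ∷ rs} (stop {R = R} ne (append refl _)) eq with ∷-injective eq
... | eq₁ , eq₂ = stop (nonEmpty-resp-length eq₁ ne) ,
  cong₂ _∷_ (trans (length-∷ʳ R) (trans (cong suc eq₁) (sym (length-∷ʳ r)))) eq₂
insert-addCell q {Q = r ∷ rs} (up ri ins) eq with ∷-injective eq
... | eq₁ , eq₂ with insert-addCell q ins eq₂
...   | ac , eq₃ = up ac , cong₂ _∷_ (trans (length-bumped ri) eq₁) eq₃

addCell-All : ∀ {P : ℕ → Set} {q i Q Q′} → AddCell q i Q Q′ → P q → All (All P) Q → All (All P) Q′
addCell-All new      p []         = (p ∷ []) ∷ []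
addCell-All (stop _) p (ps ∷ pss) = All.++⁺ ps (p ∷ []) ∷ pss
addCell-All (up ac)  p (ps ∷ pss) = ps ∷ addCell-All ac p pss

addCell-All⁻ : ∀ {P : ℕ → Set} {q i Q Q′} → AddCell q i Q Q′ → All (All P) Q′ → P q × All (All P) Q
addCell-All⁻ new              ((p ∷ []) ∷ []) = p , []
addCell-All⁻ (stop {r = r} _) (ps ∷ pss) = All.head (All.++⁻ʳ r ps) , All.++⁻ˡ r ps ∷ pss
addCell-All⁻ (up ac)          (ps ∷ pss) = let p , pss′ = addCell-All⁻ ac pss in p , ps ∷ pss′

addCell-size : ∀ {q i Q Q′} → AddCell q i Q Q′ → sum (shape Q′) ≡ suc (sum (shape Q))
addCell-size new = refl
addCell-size (stop {r} {rs} _) = cong (_+ sum (shape rs)) (length-∷ʳ r)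
addCell-size (up {r = r} ac) = trans (cong (length r +_) (addCell-size ac)) (+-suc (length r) _)

-- The last cell added is the lowest among those carrying the largest entry.
data Top (q : ℕ) : ℕ → Tableau → Set where
  here  : ∀ {Q} → All (All (_≤ q)) Q → Top q 0 Q
  above : ∀ {i r Q} → All (_< q) r → Top q i Q → Top q (suc i) (r ∷ Q)

top-max : ∀ {q i Q} → Top q i Q → All (All (_≤ q)) Q
top-max (here ps)     = ps
top-max (above ps t)  = All.map <⇒≤ ps ∷ top-max t

top-weaken : ∀ {q i j Q} → j ≤ i → Top q i Q → Top q j Q
top-weaken z≤n      t            = here (top-max t)
top-weaken (s≤s le) (above ps t) = above ps (top-weaken le t)

top-fresh : ∀ {q i Q Q′} → AddCell q i Q Q′ → All (All (_< q)) Q → Top q i Q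
top-fresh new      ps         = here (All.map (All.map <⇒≤) ps)
top-fresh (stop _) ps         = here (All.map (All.map <⇒≤) ps)
top-fresh (up ac)  (ps ∷ pss) = above ps (top-fresh ac pss)

top-add : ∀ {q i Q Q′} → AddCell q i Q Q′ → Top q i Q → Top q i Q′
top-add new         (here ps)    = here (addCell-All new ≤-refl ps)
top-add ac@(stop _) (here ps)    = here (addCell-All ac ≤-refl ps)
top-add (up ac)     (above ps t) = above ps (top-add ac t)

top-remove : ∀ {q i Q Q′} → AddCell q i Q Q′ → Top q i Q′ → Top q i Q
top-remove new         (here ps)    = here []
top-remove ac@(stop _) (here ps)    = here (proj₂ (addCell-All⁻ ac ps))
top-remove (up ac)     (above ps t) = above ps (top-remove ac t)

top-row : ∀ {q i j Q Q′} → AddCell q i Q Q′ → Top q j Q′ → j ≤ i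
top-row ac               (here _)           = z≤n
top-row new              (above (p ∷ _) _)  = contradiction p (<-irrefl refl)
top-row (stop {r = r} _) (above ps _)       = contradiction (All.head (All.++⁻ʳ r ps)) (<-irrefl refl)
top-row (up ac)          (above _ t)        = s≤s (top-row ac t)

addCell-cancel : ∀ {q i Q₁ Q₂ Q} → AddCell q i Q₁ Q → AddCell q i Q₂ Q → Q₁ ≡ Q₂
addCell-cancel ac₁ ac₂ = go ac₁ ac₂ refl
  where
  go : ∀ {q i Q₁ Q₂ Q Q′} → AddCell q i Q₁ Q → AddCell q i Q₂ Q′ → Q ≡ Q′ → Q₁ ≡ Q₂
  go new new eq = refl
  go new (stop {_ ∷ []} _) ()
  go new (stop {_ ∷ _ ∷ _} _) ()
  go (stop {_ ∷ []} _) new ()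
  go (stop {_ ∷ _ ∷ _} _) new ()
  go (stop {r} _) (stop {s} _) eq with ∷-injective eq
  ... | eq₁ , refl = cong (_∷ _) (proj₁ (∷ʳ-injective r s eq₁))
  go (up ac₁) (up ac₂) eq with ∷-injective eq
  ... | refl , eq₂ = cong (_ ∷_) (go ac₁ ac₂ eq₂)

-- Both entries occur in `Q` and bound all of it, so they agree. Each row index then bounds the
-- other, since the rows below a top cell hold only smaller entries.
addCell-injective : ∀ {q₁ q₂ i₁ i₂ Q₁ Q₂ Q} → AddCell q₁ i₁ Q₁ Q → AddCell q₂ i₂ Q₂ Q →
                    Top q₁ i₁ Q → Top q₂ i₂ Q → q₁ ≡ q₂ × i₁ ≡ i₂ × Q₁ ≡ Q₂
addCell-injective ac₁ ac₂ t₁ t₂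
  with refl ← ≤-antisym (proj₁ (addCell-All⁻ ac₁ (top-max t₂))) (proj₁ (addCell-All⁻ ac₂ (top-max t₁)))
  with refl ← ≤-antisym (top-row ac₂ t₁) (top-row ac₁ t₂)
  = refl , refl , addCell-cancel ac₁ ac₂

linked-∷ʳ : ∀ {q r} → Linked _≤_ r → All (_≤ q) r → Linked _≤_ (r ++ [ q ])
linked-∷ʳ []       []       = [-]
linked-∷ʳ [-]      (p ∷ []) = p ∷ [-]
linked-∷ʳ (p ∷ l)  (_ ∷ ps) = p ∷ linked-∷ʳ l ps

linked-∷ʳ⁻ : ∀ r {q} → Linked _≤_ (r ++ [ q ]) → Linked _≤_ r × All (_≤ q) r
linked-∷ʳ⁻ []          l       = [] , []
linked-∷ʳ⁻ (a ∷ [])    (p ∷ l) = [-] , p ∷ []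
linked-∷ʳ⁻ (a ∷ b ∷ r) (p ∷ l) with linked-∷ʳ⁻ (b ∷ r) l
... | l′ , q ∷ qs = p ∷ l′ , ≤-trans p q ∷ q ∷ qs

strictCol-append : ∀ {q r s} → All (_< q) r → length (s ++ [ q ]) ≤ length r →
                   ColRel _<_ r s → ColRel _<_ r (s ++ [ q ])
strictCol-append (p ∷ _)  _        done       = step p done
strictCol-append (_ ∷ ps) (s≤s le) (step p c) = step p (strictCol-append ps le c)

strictCol-drop : ∀ r {q s} → All (_≤ q) s → ColRel _<_ (r ++ [ q ]) s → ColRel _<_ r s
strictCol-drop []      _        done       = done
strictCol-drop []      (p ∷ _)  (step q c) = contradiction q (≤⇒≯ p)
strictCol-drop (_ ∷ r) _        done       = done
strictCol-drop (_ ∷ r) (_ ∷ ps) (step q c) = step q (strictCol-drop r ps c)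

Partition : Tableau → Set
Partition = Linked (λ r r′ → length r′ ≤ length r)

addCell-cols : ∀ {q i Q Q′} → AddCell q i Q Q′ → Top q i Q → Partition Q′ →
               Linked (ColRel _<_) Q → Linked (ColRel _<_) Q′
addCell-cols new            t            pt l = [-]
addCell-cols (stop _)       t            pt l = linked-map-head (col-extend _) l
addCell-cols (up ac@new)    (above ps t) (le ∷ pt) [-] = strictCol-append ps le done ∷ [-]
addCell-cols (up ac@(stop _)) (above ps t) (le ∷ pt) (c ∷ l) =
  strictCol-append ps le c ∷ addCell-cols ac t pt l
addCell-cols (up ac@(up _)) (above ps t) (le ∷ pt) (c ∷ l) = c ∷ addCell-cols ac t pt l

addCell-rows : ∀ {q i Q Q′} → AddCell q i Q Q′ → Top q i Q → All (Linked _≤_) Q → All (Linked _≤_) Q′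
addCell-rows new      _                []       = [-] ∷ []
addCell-rows (stop _) (here (ps ∷ _))  (l ∷ ls) = linked-∷ʳ l ps ∷ ls
addCell-rows (up ac)  (above _ t)      (l ∷ ls) = l ∷ addCell-rows ac t ls

addCell-cols⁻ : ∀ {q i r Q Q′} → AddCell q i Q Q′ → Linked (ColRel _<_) (r ∷ Q′) →
                Linked (ColRel _<_) Q → Linked (ColRel _<_) (r ∷ Q)
addCell-cols⁻ new              _       _ = [-]
addCell-cols⁻ (stop {r = r} _) (c ∷ _) l = col-unappend r c ∷ l
addCell-cols⁻ (up _)           (c ∷ _) l = c ∷ l

record LastCell (Q : Tableau) : Set where
  constructor lastCell
  field
    {entry row}  : ℕ
    {rest}       : Tableau
    added        : AddCell entry row rest Q
    top          : Top entry row Q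
    semistandard : Semistandard rest

-- Rows weakly increase, so only the last entry `q` of the bottom row competes with the winner from
-- the rows above, and a tie goes to the bottom. If `q` wins, no cell stands over it: by
-- `strictCol-drop` such a cell would carry a larger entry.
findLastCell : ∀ r rs → All NonEmpty (r ∷ rs) → Semistandard (r ∷ rs) → LastCell (r ∷ rs)
findLastCell r rs ne ss with initLast r
findLastCell .[] rs (() ∷ _) ss | []
findLastCell .(r ++ [ q ]) [] ne (l ∷ [] , _) | r ∷ʳ′ q = single r (linked-∷ʳ⁻ r l)
  where
  single : ∀ r {q} → Linked _≤_ r × All (_≤ q) r → LastCell ((r ++ [ q ]) ∷ [])
  single []        _         = lastCell new (here ((≤-refl ∷ []) ∷ [])) ([] , [])
  single (_ ∷ _) (l , ps) = lastCell (stop tt) (here (All.++⁺ ps (≤-refl ∷ []) ∷ [])) (l ∷ [] , [-])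
findLastCell .(r ++ [ q ]) (s ∷ ss) (_ ∷ ne ∷ nes) (l ∷ ls , c ∷ cs) | r ∷ʳ′ q
  with linked-∷ʳ⁻ r l | findLastCell s ss (ne ∷ nes) (ls , cs)
... | l′ , ps | lastCell {q₁} ac t (ls₁ , cs₁) with q₁ ≤? q
...   | yes q₁≤q = lastCell (stop (col-nonEmpty ne c′)) (here (All.++⁺ ps (≤-refl ∷ []) ∷ le))
                     (l′ ∷ ls , c′ ∷ cs)
  where
  le : All (All (_≤ q)) (s ∷ ss)
  le = All.map (All.map (λ p → ≤-trans p q₁≤q)) (top-max t)
  c′ : ColRel _<_ r s
  c′ = strictCol-drop r (All.head le) c
  col-nonEmpty : ∀ {r s} → NonEmpty s → ColRel _<_ r s → NonEmpty r
  col-nonEmpty _ (step _ _) = tt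
...   | no q₁≰q = lastCell (up ac) (above (All.++⁺ (All.map (λ p → ≤-<-trans p (≰⇒> q₁≰q)) ps) (≰⇒> q₁≰q ∷ [])) t)
                    (l ∷ ls₁ , addCell-cols⁻ ac (c ∷ cs) cs₁)

addCell-nonEmpty⁻ : ∀ {q i Q Q′} → AddCell q i Q Q′ → All NonEmpty Q′ → All NonEmpty Q
addCell-nonEmpty⁻ new       _          = []
addCell-nonEmpty⁻ (stop ne) (_ ∷ nes)  = ne ∷ nes
addCell-nonEmpty⁻ (up ac)   (ne ∷ nes) = ne ∷ addCell-nonEmpty⁻ ac nes

-- Reverse tableau insertion

-- The lower row is raised while the upper one still contains `y`. Undoing the upper row is then
-- harmless, as it raises entries or removes the last cell.
reverse-cols : ∀ {x y i R R′ Rs Rs′} → Sorted R → All Sorted Rs′ → RowIns x R (bumped R′ y) →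
               Insert y Rs Rs′ i → Cols (R′ ∷ Rs′) → Cols Rs → Cols (R ∷ Rs)
reverse-cols s _       ri new            _       _ = [-]
reverse-cols s (t ∷ _) ri (stop _ ri′)   (c ∷ _) l =
  col-rowIns⁻ ri′ (rowIns-raises s t (inserted∈ ri′) ri c) ∷ l
reverse-cols s (t ∷ _) ri (up ri′ _)     (c ∷ _) l =
  col-rowIns⁻ ri′ (rowIns-raises s t (inserted∈ ri′) ri c) ∷ l

insert-below : ∀ {y i R Rs Rs′} → Insert y Rs Rs′ i → Cols (R ∷ Rs′) → ∃[ a ] (a ∈ R × a ≤ y)
insert-below new         (c ∷ _) = col-below c (here refl)
insert-below (stop _ ri) (c ∷ _) = col-below c (inserted∈ ri)
insert-below (up ri _)   (c ∷ _) = col-below c (inserted∈ ri)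

record Preimage (P′ Q : Tableau) (i : ℕ) : Set where
  constructor preimage
  field
    {letter} : ℕ
    {tab}    : Tableau
    insert   : Insert letter tab P′ i
    sorted   : All Sorted tab
    cols     : Cols tab
    shape≡   : shape tab ≡ shape Q
    word     : (rowWord tab ++ [ letter ]) ≈H rowWord P′

-- The upper rows are undone before the lower ones and yield the letter `y` that they received.
-- Rewriting the row word accordingly puts `y` in front of `R′`, so `y ∷ R′` inherits the absence of
-- braids that `reverse-rowIns` requires.
reverse-insert : ∀ {q i Q Q′} P′ → AddCell q i Q Q′ → Partition Q → shape P′ ≡ shape Q′ →
                 All Sorted P′ → Cols P′ → NoBraid (rowWord P′) → Preimage P′ Q i
reverse-insert ((_ ∷ []) ∷ []) new _ refl _ _ _ = preimage new [] [] refl ≈-refl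
reverse-insert (R ∷ Rs) (stop {r} {rs} ne) pt eq (s ∷ ss) cs nb with ∷-injective eq | initLast R
... | eq₁ , _   | [] = contradiction (trans eq₁ (length-∷ʳ r)) λ ()
... | eq₁ , eq₂ | R₀ ∷ʳ′ x =
  preimage (stop (nonEmpty-resp-length (sym eq₀) ne) (append refl (sorted-left R₀ s)))
    (sorted-++ˡ R₀ s ∷ ss) (shorten rs eq₂ pt cs) (cong₂ _∷_ eq₀ eq₂)
    (≈-reflexive (trans (rowWord-∷ʳ x R₀ Rs) (sym (rowWord-∷ (R₀ ++ [ x ]) Rs))))
  where
  eq₀ : length R₀ ≡ length r
  eq₀ = suc-injective (trans (sym (length-∷ʳ R₀)) (trans eq₁ (length-∷ʳ r)))
  shorten : ∀ {Rs} rs → shape Rs ≡ shape rs → Partition (r ∷ rs) → Cols ((R₀ ++ [ x ]) ∷ Rs) → Cols (R₀ ∷ Rs)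
  shorten _       eq pt       [-]     = [-]
  -- The removed cell is a corner: by `le` the row above is no longer than `R₀`.
  shorten (s ∷ _) eq (le ∷ _) (c ∷ l) =
    col-unextend R₀ (subst₂ _≤_ (sym (∷-injectiveˡ eq)) (sym eq₀) le) c ∷ l
reverse-insert (R′ ∷ Rs′) (up ac) pt eq (s ∷ ss) cs nb with ∷-injective eq
... | eq₁ , eq₂ with reverse-insert Rs′ ac (Linked.tail pt) eq₂ ss (Linked.tail cs)
                       (noBraid-++ˡ (rowWord Rs′) (subst NoBraid (rowWord-∷ R′ Rs′) nb))
...   | preimage {y} {Rs} ins ss₀ cs₀ sh wd with insert-below ins cs
...     | a , a∈ , a≤y with reverse-rowIns s a∈ a≤y (noBraid-++ʳ (rowWord Rs) (noBraid-resp below nb))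
  where
  open ≈-Reasoning
  below : rowWord (R′ ∷ Rs′) ≈H (rowWord Rs ++ y ∷ R′)
  below = begin
    rowWord (R′ ∷ Rs′)            ≡⟨ rowWord-∷ R′ Rs′ ⟩
    rowWord Rs′ ++ R′             ≈⟨ ++-congʳ R′ wd ⟨
    (rowWord Rs ++ [ y ]) ++ R′   ≡⟨ ++-assoc (rowWord Rs) [ y ] R′ ⟩
    rowWord Rs ++ y ∷ R′          ∎
...       | rowPreimage ri s₀ clear =
  preimage (up ri ins) (s₀ ∷ ss₀) (reverse-cols s₀ ss ri ins cs cs₀)
    (cong₂ _∷_ (trans (sym (length-bumped ri)) eq₁) sh)
    (rowWord-up Rs (rowIns-≈ s₀ clear ri) Rs′ wd)

-- The insertion of a biword

-- `Top` refers to the recording tableau after the step, so the final `Q` alone determines the last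
-- cell and its entry.
data Trace : Biword → Tableau → Tableau → Set where
  []     : Trace [] [] []
  insert : ∀ {w P P′ Q Q′ q x i} → Trace w P Q → All Sorted P → NoBraid (rowWord P ++ [ x ]) →
           Insert x P P′ i → AddCell q i Q Q′ → Top q i Q′ → Trace ((q , x) ∷ w) P′ Q′

trace-injective : ∀ {w w′ P Q} → Trace w P Q → Trace w′ P Q → w ≡ w′
trace-injective [] [] = refl
trace-injective [] (insert _ _ _ () _ _)
trace-injective (insert _ _ _ () _ _) []
trace-injective (insert tr s nb ins ac t) (insert tr′ s′ nb′ ins′ ac′ t′)
  with refl , refl , refl ← addCell-injective ac ac′ t t′
  with refl , refl ← insert-injective s s′ nb nb′ ins ins′
  = cong (_ ∷_) (trace-injective tr tr′)

trace-star : ∀ {w P Q} → Trace w P Q → star w ≡ (P , Q)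
trace-star [] = refl
trace-star (insert tr s _ ins ac _) rewrite trace-star tr | insertP-≡ s ins | addCell-≡ ac = refl

trace-All : ∀ {p : ℕ → Set} {w P Q} → Trace w P Q → All (p ∘ proj₁) w → All (All p) Q
trace-All [] [] = []
trace-All (insert tr _ _ _ ac _) (px ∷ ps) = addCell-All ac px (trace-All tr ps)

trace-All⁻ : ∀ {p : ℕ → Set} {w P Q} → Trace w P Q → All (All p) Q → All (p ∘ proj₁) w
trace-All⁻ [] _ = []
trace-All⁻ (insert tr _ _ _ ac _) ps =
  let px , ps′ = addCell-All⁻ ac ps in px ∷ trace-All⁻ tr ps′

-- A strictly larger `q` exceeds all of `Q`, and any row will do. For an equal `q` the biword has a
-- larger letter, so `pieri-<` puts the new cell weakly below the previous one.
trace-top : ∀ {w P P′ Q Q′ q x i} → Trace w P Q → Linked DecCols ((q , x) ∷ w) →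
            Insert x P P′ i → AddCell q i Q Q′ → Top q i Q
trace-top [] _ _ new = here []
trace-top (insert _ s nb ins ac t) ((q₀≤q , dec) ∷ _) ins′ ac′ with m≤n⇒m<n∨m≡n q₀≤q
... | inj₁ q₀<q = top-fresh ac′ (All.map (All.map (λ p → ≤-<-trans p q₀<q)) (top-max t))
... | inj₂ refl = top-weaken (pieri-< s nb (dec refl) ins ins′) t

-- For equal entries, `x ≤ x₀` would put the new cell strictly above the previous one by `pieri-≤`,
-- so that it would not be the lowest.
trace-decCols : ∀ {w P P′ Q Q′ q x i} → Trace w P Q → Linked DecCols w →
                Insert x P P′ i → AddCell q i Q Q′ → Top q i Q′ → Linked DecCols ((q , x) ∷ w)
trace-decCols [] _ _ _ _ = [-]
trace-decCols {q = q} {x} (insert {q = q₀} {x₀} _ s _ ins ac _) l ins′ ac′ t′ =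
  (proj₁ (addCell-All⁻ ac (top-max t)) , dec) ∷ l
  where
  t = top-remove ac′ t′
  dec : q ≡ q₀ → x₀ < x
  dec refl = ≰⇒> λ x≤x₀ → ≤⇒≯ (top-row ac t) (pieri-≤ s x≤x₀ ins ins′)

-- Reversed because the last column is inserted first and each inserted letter multiplies the row
-- word on the right.
letters : Biword → Word
letters w = reverse (map proj₂ w)

letters-∷ : ∀ q x w → letters ((q , x) ∷ w) ≡ letters w ++ [ x ]
letters-∷ q x w = unfold-reverse x (map proj₂ w)

cols⇒partition : ∀ {_∼_ T} → Linked (ColRel _∼_) T → Partition T
cols⇒partition = Linked.map col-length

partition-resp-shape : ∀ {P Q} → shape P ≡ shape Q → Partition P → Partition Q
partition-resp-shape {[]} {[]} _ _ = []
partition-resp-shape {_ ∷ []} {_ ∷ []} _ _ = [-]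
partition-resp-shape {_ ∷ _ ∷ _} {_ ∷ _ ∷ _} eq (le ∷ pt) =
  subst₂ _≤_ (∷-injectiveˡ (∷-injectiveʳ eq)) (∷-injectiveˡ eq) le ∷ partition-resp-shape (∷-injectiveʳ eq) pt

record Output (w : Biword) : Set where
  constructor output
  field
    {P Q}        : Tableau
    trace        : Trace w P Q
    nonEmpty     : All NonEmpty P
    sorted       : All Sorted P
    cols         : Cols P
    shape≡       : shape P ≡ shape Q
    semistandard : Semistandard Q
    word         : letters w ≈H rowWord P

star-output : ∀ w → Linked DecCols w → NoBraid (letters w) → Output w
star-output [] _ _ = output [] [] [] [] refl ([] , []) ≈-refl
star-output ((q , x) ∷ w) dec nb
  with output {P} {Q} tr ne s cs sh (rows , qcs) wd ← star-output w (Linked.tail dec)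
         (noBraid-++ˡ (letters w) (subst NoBraid (letters-∷ q x w) nb))
  = output (insert tr s nb′ ins ac (top-add ac t)) (insert-nonEmpty ne ins) (insert-sorted s ins)
      cs′ sh′ (addCell-rows ac t rows , addCell-cols ac t (partition-resp-shape sh′ (cols⇒partition cs′)) qcs)
      (≈-trans wd′ (insert-≈ s nb′ ins))
  where
  wd′ : letters ((q , x) ∷ w) ≈H (rowWord P ++ [ x ])
  wd′ = ≈-trans (≈-reflexive (letters-∷ q x w)) (++-congʳ [ x ] wd)
  nb′ : NoBraid (rowWord P ++ [ x ])
  nb′ = noBraid-resp wd′ nb
  ins = insertP-correct x ne s
  ac  = proj₁ (insert-addCell q ins sh)
  sh′ = proj₂ (insert-addCell q ins sh)
  t   = trace-top tr dec ins ac
  cs′ = insert-cols s ins cs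

record Source (P Q : Tableau) : Set where
  constructor source
  field
    {biword} : Biword
    trace    : Trace biword P Q
    decCols  : Linked DecCols biword
    word     : letters biword ≈H rowWord P

star-source : ∀ n P Q → sum (shape Q) ≡ n → All NonEmpty Q → All Sorted P → Cols P → shape P ≡ shape Q →
              Semistandard Q → NoBraid (rowWord P) → Source P Q
star-source n [] [] _ _ _ _ _ _ _ = source [] [] ≈-refl
star-source n P (r ∷ rs) size ne s cs sh ss nb with findLastCell r rs ne ss
... | lastCell {q} {Q₀} {rest} ac t ss₀
  with reverse-insert P ac (cols⇒partition (proj₂ ss₀)) sh s cs nb
...   | preimage {x} {P₀} ins s₀ cs₀ sh₀ wd with n | trans (sym (addCell-size ac)) size
...     | suc m | size₀
  with source {w} tr dec wd₀ ← star-source m P₀ rest (suc-injective size₀) (addCell-nonEmpty⁻ ac ne) s₀ cs₀ sh₀ ss₀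
         (noBraid-++ˡ (rowWord P₀) (noBraid-resp (≈-sym wd) nb))
  = source (insert tr s₀ (noBraid-resp (≈-sym wd) nb) ins ac t) (trace-decCols tr dec ins ac t)
      (≈-trans (≈-reflexive (letters-∷ q x w)) (≈-trans (++-congʳ [ x ] wd₀) wd))

-- Well-definedness, injectivity and surjectivity of the insertion

All-reverse⁺ : ∀ {p : ℕ → Set} {w} → All p w → All p (reverse w)
All-reverse⁺ ps = All.tabulate (All.lookup ps ∘ Any.reverse⁻)

fc⇒noBraid-letters : ∀ w → FullyCommutative (map proj₂ w) → NoBraid (letters w)
fc⇒noBraid-letters w fc = noBraid-reverse (fc⇒noBraid fc)

positive-rows : ∀ P → All (1 ≤_) (rowWord P) → All (All (1 ≤_)) P
positive-rows [] _ = []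
positive-rows (R ∷ Rs) ps with subst (All (1 ≤_)) (rowWord-∷ R Rs) ps
... | ps′ = All.++⁻ʳ (rowWord Rs) ps′ ∷ positive-rows Rs (All.++⁻ˡ (rowWord Rs) ps′)

positive-rowWord : ∀ P → All (All (1 ≤_)) P → All (1 ≤_) (rowWord P)
positive-rowWord [] [] = []
positive-rowWord (R ∷ Rs) (p ∷ ps) =
  subst (All (1 ≤_)) (sym (rowWord-∷ R Rs)) (All.++⁺ (positive-rowWord Rs ps) p)

star-target : ∀ w → IsFCDecHeckeBiword w → IsTargetPair (star w)
star-target w (pos , dec , fc)
  with output {P} {Q} tr ne s cs sh ss wd ← star-output w dec (fc⇒noBraid-letters w fc)
  rewrite trace-star tr =
  (ne , positive-rows P (All-resp-≈H wd (All-reverse⁺ (All.map⁺ (All.map proj₂ pos)))) , cols⇒partition cs) ,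
  (nonEmpty-resp-shape sh ne , trace-All tr (All.map proj₁ pos) , cols⇒partition (proj₂ ss)) ,
  sh , (All.map AllPairs⇒Linked s , cs) , ss , noBraid⇒fc (noBraid-resp wd (fc⇒noBraid-letters w fc))

star-injective : ∀ w w′ → IsFCDecHeckeBiword w → IsFCDecHeckeBiword w′ → star w ≡ star w′ → w ≡ w′
star-injective w w′ (_ , dec , fc) (_ , dec′ , fc′) eq
  with output tr _ _ _ _ _ _  ← star-output w dec (fc⇒noBraid-letters w fc)
     | output tr′ _ _ _ _ _ _ ← star-output w′ dec′ (fc⇒noBraid-letters w′ fc′)
  with refl ← trans (sym (trace-star tr)) (trans eq (trace-star tr′))
  = trace-injective tr tr′

star-surjective : ∀ PQ → IsTargetPair PQ → ∃[ w ] (IsFCDecHeckeBiword w × star w ≡ PQ)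
star-surjective (P , Q) ((_ , posP , _) , (ne , posQ , _) , sh , (s , cs) , ss , fc)
  with source {w} tr dec wd ← star-source (sum (shape Q)) P Q refl ne
         (All.map (Linked⇒AllPairs <-trans) s) cs sh ss (fc⇒noBraid fc)
  = w , (All.zip (trace-All⁻ tr posQ , All.map⁻ (unreverse (All (1 ≤_)) All-reverse⁺
           (All-resp-≈H (≈-sym wd) (positive-rowWord P posP)))) ,
         dec , noBraid⇒fc (unreverse NoBraid noBraid-reverse (noBraid-resp (≈-sym wd) (fc⇒noBraid fc)))) ,
    trace-star tr
  where
  unreverse : (p : Word → Set) → (∀ {v} → p v → p (reverse v)) → ∀ {v} → p (reverse v) → p v
  unreverse p rev {v} = subst p (reverse-involutive v) ∘ rev

theorem3p16 : (∀ w → IsFCDecHeckeBiword w → IsTargetPair (star w)) ×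
    (∀ w w' → IsFCDecHeckeBiword w → IsFCDecHeckeBiword w' →
    star w ≡ star w' → w ≡ w') ×
    (∀ PQ → IsTargetPair PQ → ∃[ w ] (IsFCDecHeckeBiword w × star w ≡ PQ))
theorem3p16 = star-target , star-injective , star-surjective
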